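{- Let $k\ge 1$ and $0\le r<k$ be integers, and let $n\ge 0$ be an integer. Let $$A_n(k,r,x;q)=\left(q^{(k-r-1)j}\begin{bmatrix} i-k+r+1\\ j\end{bmatrix}x^k+q^{(k-r)j}\begin{bmatrix} i+r+1\\ j+1\end{bmatrix}\right)_{i,j=0}^{n-1}.$$ Then $x^r\det A_n(k,r,x;q)=F^{(k)}_{kn+r}(x;q)$.
   Context: For an integer $a$ (possibly negative) and integer $m$, the $q$-binomial coefficient is $\begin{bmatrix} a\\ m\end{bmatrix}=\prod_{t=0}^{m-1}\frac{1-q^{a-t}}{1-q^{t+1}}$ for $m\ge 0$ and $0$ for $m<0$ (for $a\ge 0$ this is the usual Gaussian binomial, vanishing for $m>a$). For a positive integer $k$, the $q$-Fibonacci polynomials $F^{(k)}_N(x;q)$ are defined by $F^{(k)}_N(x;q)=x^N$ for $0\le N<k$ and $F^{(k)}_{N+k}(x;q)=xF^{(k)}_{N+k-1}(x;q)+q^NF^{(k)}_N(x;q)$ for $N\ge 0$; explicitly $F^{(k)}_N(x;q)=\sum_{j=0}^{\lfloor N/k\rfloor}q^{k\binom{j}{2}}\begin{bmatrix} N-(k-1)j\\ j\end{bmatrix}x^{N-kj}$. The determinant of a $0\times 0$ matrix is $1$. -}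

module Defs where

open import Level using (Level)
open import Algebra.Bundles using (CommutativeRing)
open import Data.Nat as ℕ using (ℕ; zero; suc; _<?_; _∸_)
open import Data.Integer as ℤ using (ℤ; +_; -[1+_])
open import Data.Fin using (Fin; zero; suc; punchIn; toℕ)
open import Relation.Nullary using (yes; no)

tri : ℕ → ℕ
tri zero    = zero
tri (suc m) = m ℕ.+ tri m

module WithRing {c ℓ : Level} (R : CommutativeRing c ℓ) where
  open CommutativeRing R hiding (zero)

  infixr 8 _^_
  _^_ : Carrier → ℕ → Carrier
  a ^ zero  = 1#
  a ^ suc n = a * (a ^ n)

  Σ : (n : ℕ) → (Fin n → Carrier) → Carrier
  Σ zero    f = 0#
  Σ (suc n) f = f zero + Σ n (λ j → f (suc j))

  det : (n : ℕ) → (Fin n → Fin n → Carrier) → Carrier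
  det zero    M = 1#
  det (suc n) M =
    Σ (suc n) (λ j → ((- 1#) ^ toℕ j) * (M zero j * det n (λ a b → M (suc a) (punchIn j b))))

  gauss : Carrier → ℕ → ℕ → Carrier
  gauss q zero    zero    = 1#
  gauss q zero    (suc m) = 0#
  gauss q (suc a) zero    = 1#
  gauss q (suc a) (suc m) = gauss q a m + (q ^ suc m) * gauss q a (suc m)

  -- q-binomial [a choose m] for integer a, m ≥ 0, with q invertible (qi = q⁻¹):
  --   for a = -b (b ≥ 1):  prod_{t<m} (1-q^{-b-t})/(1-q^{t+1})
  --     = (-1)^m q^{-(bm + m(m-1)/2)} [b+m-1 choose m]
  qbinom : (q qi : Carrier) → ℤ → ℕ → Carrier
  qbinom q qi (+ a)      m = gauss q a m
  qbinom q qi -[1+ b ]   m =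
    ((- 1#) ^ m) * ((qi ^ (suc b ℕ.* m ℕ.+ tri m)) * gauss q (b ℕ.+ m) m)

  fibAux : (k : ℕ) (x q : Carrier) → ℕ → ℕ → Carrier
  fibAux k x q zero     N = 0#
  fibAux k x q (suc fu) N with N <? k
  ... | yes _ = x ^ N
  ... | no  _ = x * fibAux k x q fu (N ∸ 1) + (q ^ (N ∸ k)) * fibAux k x q fu (N ∸ k)

  -- F^{(k)}_N(x;q)  (fuel N+1 suffices when k ≥ 1)
  qFib : (k : ℕ) (x q : Carrier) → ℕ → Carrier
  qFib k x q N = fibAux k x q (suc N) N

  Amat : (k r : ℕ) (x q qi : Carrier) (n : ℕ) → Fin n → Fin n → Carrier
  Amat k r x q qi n i j =
      (q ^ ((k ∸ r ∸ 1) ℕ.* toℕ j)) * (qbinom q qi ((+ (toℕ i ℕ.+ r ℕ.+ 1)) ℤ.- (+ k)) (toℕ j) * (x ^ k))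
    + (q ^ ((k ∸ r) ℕ.* toℕ j)) * qbinom q qi (+ (toℕ i ℕ.+ r ℕ.+ 1)) (suc (toℕ j))

module Submission where

open import Defs
open import Level using (Level)
open import Algebra.Bundles using (CommutativeRing)
open import Data.Nat as ℕ using (ℕ; zero; suc; s≤s; z≤n)
import Data.Nat.Properties as ℕ
open import Data.Integer as ℤ using (ℤ; +_; -[1+_])
import Data.Integer.Properties as ℤ
open import Data.Integer.Tactic.RingSolver using (solve-∀)
open import Data.Fin using (Fin; zero; suc; punchIn; toℕ)
import Data.Fin.Properties as Fin
open import Data.Product using (∃; _,_)
open import Data.Vec.Functional using (_∷_)
open import Function using (_∘_)
open import Relation.Binary.PropositionalEquality as ≡ using (_≡_; _≢_; _≗_)
open import Relation.Nullary using (yes; no; contradiction)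
import Algebra.Properties.Ring
import Algebra.Solver.Ring.NaturalCoefficients.Default
import Relation.Binary.Reasoning.Setoid

-- By q-Newton interpolation along the rows, A = L B with L = ([i, l]) unitriangular and B upper
-- Hessenberg, each entry of B being a sum of two q-binomials with integer upper index. So det A =
-- det B is computed by eliminating the first row of x^r B, and the multipliers turn out to be
-- κ_l F_{kl+r}. That they annihilate the columns of B is the identity P^c = x^k P^{c-k}, c = r + 1,
-- for P^c_j = Σ_l (-1)^l q^{-lj-(k-1)l(l-1)/2} [c, j+1-l] F_{kl+c-1} with F = 0 at negative indices:
-- the q-Pascal rule and the recurrence of F give x P^c = P^{c+1} for -k < c < k by telescoping.

-- The two q-binomials in an entry of `B` have upper indices r + 1 - k ≤ 0 and r + 1 ≥ 1, so the k
-- steps of c between them always cross c = 0. This has two consequences: the q-Pascal rule is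
-- needed for negative upper indices, and the step at c = 0 meets the one place where the recurrence
-- of the zero-extended F fails. There the coefficient is [0, j+1] = 0, so no correction term
-- appears. The factor x^r enters because the multiplier of row 0 is κ_0 F_r = x^r: scaling that row
-- by it makes the column relation usable for elimination without dividing by x.

-- Finite sums and signs in a commutative ring

module Sums {c ℓ : Level} (R : CommutativeRing c ℓ) where
  open CommutativeRing R hiding (zero)
  open WithRing R
  open Algebra.Solver.Ring.NaturalCoefficients.Default commutativeSemiring
  open Relation.Binary.Reasoning.Setoid setoid

  Σ-cong : ∀ n {f g : Fin n → Carrier} → (∀ i → f i ≈ g i) → Σ n f ≈ Σ n g
  Σ-cong zero    e = refl
  Σ-cong (suc n) e = +-cong (e zero) (Σ-cong n (λ i → e (suc i)))

  Σ-0 : ∀ n {f : Fin n → Carrier} → (∀ i → f i ≈ 0#) → Σ n f ≈ 0#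
  Σ-0 zero    e = refl
  Σ-0 (suc n) e = trans (+-cong (e zero) (Σ-0 n (λ i → e (suc i)))) (+-identityʳ 0#)

  Σ-+ : ∀ n (f g : Fin n → Carrier) → Σ n (λ i → f i + g i) ≈ Σ n f + Σ n g
  Σ-+ zero    f g = sym (+-identityʳ 0#)
  Σ-+ (suc n) f g = trans (+-congˡ (Σ-+ n (f ∘ suc) (g ∘ suc)))
    (solve 4 (λ a b s t → (a :+ b) :+ (s :+ t) := (a :+ s) :+ (b :+ t)) refl _ _ _ _)

  *-Σ : ∀ n a (f : Fin n → Carrier) → a * Σ n f ≈ Σ n (λ i → a * f i)
  *-Σ zero    a f = zeroʳ a
  *-Σ (suc n) a f = trans (distribˡ a _ _) (+-congˡ (*-Σ n a (f ∘ suc)))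

  Σ-linear : ∀ n a (f g h : Fin n → Carrier) → (∀ i → h i ≈ f i + a * g i) →
             Σ n h ≈ Σ n f + a * Σ n g
  Σ-linear n a f g h e = begin
    Σ n h                          ≈⟨ Σ-cong n e ⟩
    Σ n (λ i → f i + a * g i)      ≈⟨ Σ-+ n f _ ⟩
    Σ n f + Σ n (λ i → a * g i)    ≈⟨ +-congˡ (sym (*-Σ n a g)) ⟩
    Σ n f + a * Σ n g              ∎

  Σ-last : ∀ n (f : ℕ → Carrier) → Σ (suc n) (f ∘ toℕ) ≈ Σ n (f ∘ toℕ) + f n
  Σ-last zero    f = +-comm _ _
  Σ-last (suc n) f = trans (+-congˡ (Σ-last n (f ∘ suc))) (sym (+-assoc _ _ _))

  -- Telescoping without subtraction: `u l` is the boundary term handed from one index to the next,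
  -- so only its two end values remain.
  Σ-telescope : ∀ n (f g u : ℕ → Carrier) → (∀ l → f l + u l ≈ g l + u (suc l)) →
                Σ n (f ∘ toℕ) + u 0 ≈ Σ n (g ∘ toℕ) + u n
  Σ-telescope zero    f g u e = refl
  Σ-telescope (suc n) f g u e = begin
    (f 0 + Σ n (f ∘ suc ∘ toℕ)) + u 0
      ≈⟨ solve 3 (λ a b s → (a :+ b) :+ s := (a :+ s) :+ b) refl _ _ _ ⟩
    (f 0 + u 0) + Σ n (f ∘ suc ∘ toℕ)
      ≈⟨ +-congʳ (e 0) ⟩
    (g 0 + u 1) + Σ n (f ∘ suc ∘ toℕ)
      ≈⟨ solve 3 (λ a b s → (a :+ b) :+ s := a :+ (s :+ b)) refl _ _ _ ⟩
    g 0 + (Σ n (f ∘ suc ∘ toℕ) + u 1)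
      ≈⟨ +-congˡ (Σ-telescope n (f ∘ suc) (g ∘ suc) (u ∘ suc) (λ l → e (suc l))) ⟩
    g 0 + (Σ n (g ∘ suc ∘ toℕ) + u (suc n))
      ≈⟨ sym (+-assoc _ _ _) ⟩
    (g 0 + Σ n (g ∘ suc ∘ toℕ)) + u (suc n) ∎

  -1*x+x≈0 : ∀ x → (- 1#) * x + x ≈ 0#
  -1*x+x≈0 x = begin
    (- 1#) * x + x       ≈⟨ +-congˡ (sym (*-identityˡ x)) ⟩
    (- 1#) * x + 1# * x  ≈⟨ sym (distribʳ x _ _) ⟩
    ((- 1#) + 1#) * x    ≈⟨ *-congʳ (-‿inverseˡ 1#) ⟩
    0# * x               ≈⟨ zeroˡ x ⟩
    0#                   ∎

  +-cancelʳ : ∀ {x y z} → x + z ≈ y + z → x ≈ y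
  +-cancelʳ {x} {y} {z} = Algebra.Properties.Ring.+-cancelʳ ring z x y

  -1*-1≈1 : (- 1#) * (- 1#) ≈ 1#
  -1*-1≈1 = +-cancelʳ {z = - 1#} (trans (-1*x+x≈0 (- 1#)) (sym (-‿inverseʳ 1#)))

-- Determinants by Laplace expansion along the first row

module Determinants {c ℓ : Level} (R : CommutativeRing c ℓ) where
  open CommutativeRing R hiding (zero)
  open WithRing R
  open Sums R
  open Algebra.Solver.Ring.NaturalCoefficients.Default commutativeSemiring
  open Relation.Binary.Reasoning.Setoid setoid

  Row : ℕ → Set c
  Row n = Fin n → Carrier

  sgn : ∀ {n} → Fin n → Carrier
  sgn j = (- 1#) ^ toℕ j

  laplace : ∀ n → Row n → (Fin n → Carrier) → Carrier
  laplace n u D = Σ n λ j → sgn j * (u j * D j)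

  laplace-cong : ∀ n (u v : Row n) (D E : Fin n → Carrier) →
                 (∀ j → u j ≈ v j) → (∀ j → D j ≈ E j) → laplace n u D ≈ laplace n v E
  laplace-cong n u v D E p q = Σ-cong n λ j → *-congˡ (*-cong (p j) (q j))

  laplace-0 : ∀ n (u : Row n) (D : Fin n → Carrier) → (∀ j → D j ≈ 0#) → laplace n u D ≈ 0#
  laplace-0 n u D e = Σ-0 n λ j → trans (*-congˡ (trans (*-congˡ (e j)) (zeroʳ (u j)))) (zeroʳ (sgn j))

  minor : ∀ {n} → (Fin (suc n) → Row (suc n)) → Fin (suc n) → Fin n → Row n
  minor M j a b = M (suc a) (punchIn j b)

  det-cong : ∀ n (M N : Fin n → Row n) → (∀ i j → M i j ≈ N i j) → det n M ≈ det n N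
  det-cong zero    M N e = refl
  det-cong (suc n) M N e = laplace-cong (suc n) (M zero) (N zero) _ _ (e zero)
    (λ j → det-cong n (minor M j) (minor N j) (λ a b → e (suc a) (punchIn j b)))

  ∷-cong : ∀ {m n} {u v : Row n} {h k : Fin m → Row n} →
           (∀ j → u j ≈ v j) → (∀ i j → h i j ≈ k i j) → ∀ i j → (u ∷ h) i j ≈ (v ∷ k) i j
  ∷-cong p q zero    j = p j
  ∷-cong p q (suc i) j = q i j

  ∷-η : ∀ {m n} (h : Fin (suc m) → Row n) → ∀ i j → h i j ≈ (h zero ∷ h ∘ suc) i j
  ∷-η h zero    j = refl
  ∷-η h (suc i) j = refl

  det-∷-η : ∀ n (v : Row (suc (suc n))) h →
            det (suc (suc n)) (v ∷ h) ≈ det (suc (suc n)) (v ∷ h zero ∷ h ∘ suc)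
  det-∷-η n v h = det-cong (suc (suc n)) (v ∷ h) (v ∷ h zero ∷ h ∘ suc)
    (∷-cong (λ j → refl) (∷-η h))

  minor-∷ : ∀ n (v : Row (suc (suc n))) h j →
            det (suc n) (λ a b → (v ∷ h) a (punchIn j b)) ≈
            det (suc n) (v ∘ punchIn j ∷ λ a → h a ∘ punchIn j)
  minor-∷ n v h j = det-cong (suc n) (λ a b → (v ∷ h) a (punchIn j b))
    (v ∘ punchIn j ∷ λ a → h a ∘ punchIn j) λ { zero b → refl ; (suc a) b → refl }

  -- The double Laplace expansion along two rows u, v; φ stands for the minor
  -- of the remaining rows, as a function of the selected columns.
  two-rows : ∀ n (u v : Row (suc (suc n))) → ((Fin n → Fin (suc (suc n))) → Carrier) → Carrier
  two-rows n u v φ = Σ (suc (suc n)) λ j → sgn j * (u j *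
    Σ (suc n) λ l → sgn l * (v (punchIn j l) * φ (punchIn j ∘ punchIn l)))

  private
    -- Selections of columns are functions that agree only pointwise (see `lift-punchIn`), so φ is
    -- required to respect `≗`.
    Respects : ∀ {m n} → ((Fin m → Fin n) → Carrier) → Set _
    Respects φ = ∀ {f g} → f ≗ g → φ f ≈ φ g

    lift : ∀ {m n} → (Fin m → Fin n) → Fin (suc m) → Fin (suc n)
    lift f zero    = zero
    lift f (suc i) = suc (f i)

    lift-cong : ∀ {m n} {f g : Fin m → Fin n} → f ≗ g → lift f ≗ lift g
    lift-cong e zero    = ≡.refl
    lift-cong e (suc i) = ≡.cong suc (e i)

    lift-punchIn : ∀ {n} (j : Fin (suc (suc n))) (l : Fin (suc n)) →
                   punchIn (suc j) ∘ punchIn (suc l) ≗ lift (punchIn j ∘ punchIn l)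
    lift-punchIn j l zero    = ≡.refl
    lift-punchIn j l (suc i) = ≡.refl

    edge : ∀ n → Row (suc (suc n)) → ((Fin n → Fin (suc (suc n))) → Carrier) → Carrier
    edge n v φ = Σ (suc n) λ l → sgn l * (v (suc l) * φ (suc ∘ punchIn l))

    rest : ∀ n (u v : Row (suc (suc n))) → ((Fin n → Fin (suc (suc n))) → Carrier) → Carrier
    rest n u v φ = Σ (suc n) λ j → sgn j * (u (suc j) *
      Σ n λ l → sgn l * (v (suc (punchIn j l)) * φ (punchIn (suc j) ∘ punchIn (suc l))))

    -- Sorts the pairs of columns by which row takes column zero: neither (`rest`), u, or v. If v
    -- takes it, u stands in a column `suc j` with sign `sgn (suc j)`, which is the extra factor
    -- `- 1#`. In `rest` both positions shift by one and the two signs cancel.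
    two-rows-split : ∀ n u v φ →
      two-rows n u v φ ≈ rest n u v φ + (u zero * edge n v φ + (- 1#) * (v zero * edge n u φ))
    two-rows-split n u v φ = begin
      1# * (u zero * edge n v φ) + Σ (suc n) (λ j → sgn (suc j) * (u (suc j) * I j))
        ≈⟨ +-cong (*-identityˡ _) (Σ-linear (suc n) ((- 1#) * v zero) F G _ step) ⟩
      u zero * edge n v φ + (rest n u v φ + ((- 1#) * v zero) * edge n u φ)
        ≈⟨ solve 5 (λ a s m w e → a :+ (s :+ (m :* w) :* e) := s :+ (a :+ m :* (w :* e)))
             refl _ _ _ _ _ ⟩
      rest n u v φ + (u zero * edge n v φ + (- 1#) * (v zero * edge n u φ)) ∎
      where
      I : Fin (suc n) → Carrier
      I j = Σ (suc n) λ l → sgn l * (v (punchIn (suc j) l) * φ (punchIn (suc j) ∘ punchIn l))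
      K : Fin (suc n) → Carrier
      K j = Σ n λ l → sgn l * (v (suc (punchIn j l)) * φ (punchIn (suc j) ∘ punchIn (suc l)))
      F G : Fin (suc n) → Carrier
      F j = sgn j * (u (suc j) * K j)
      G j = sgn j * (u (suc j) * φ (suc ∘ punchIn j))
      I-split : ∀ j → I j ≈ v zero * φ (suc ∘ punchIn j) + (- 1#) * K j
      I-split j = +-cong (*-identityˡ _)
        (trans (Σ-cong n (λ l → *-assoc _ _ _)) (sym (*-Σ n (- 1#) _)))
      step : ∀ j → sgn (suc j) * (u (suc j) * I j) ≈ F j + ((- 1#) * v zero) * G j
      step j = begin
        ((- 1#) * sgn j) * (u (suc j) * I j)
          ≈⟨ *-congˡ (*-congˡ (I-split j)) ⟩
        ((- 1#) * sgn j) * (u (suc j) * (v zero * φ (suc ∘ punchIn j) + (- 1#) * K j))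
          ≈⟨ solve 6 (λ m s a w f k → (m :* s) :* (a :* (w :* f :+ m :* k))
               := (m :* m) :* (s :* (a :* k)) :+ (m :* w) :* (s :* (a :* f)))
               refl (- 1#) (sgn j) (u (suc j)) (v zero) (φ (suc ∘ punchIn j)) (K j) ⟩
        ((- 1#) * (- 1#)) * F j + ((- 1#) * v zero) * G j
          ≈⟨ +-congʳ (trans (*-congʳ -1*-1≈1) (*-identityˡ _)) ⟩
        F j + ((- 1#) * v zero) * G j ∎

    rest-suc : ∀ n u v φ → Respects φ →
               rest (suc n) u v φ ≈ two-rows n (u ∘ suc) (v ∘ suc) (φ ∘ lift)
    rest-suc n u v φ φ-cong = laplace-cong (suc (suc n)) (u ∘ suc) (u ∘ suc) _ _ (λ j → refl)
      λ j → laplace-cong (suc n) (v ∘ suc ∘ punchIn j) (v ∘ suc ∘ punchIn j) _ _ (λ l → refl)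
        λ l → φ-cong (lift-punchIn j l)

    rest-0 : ∀ u v φ → rest 0 u v φ ≈ 0#
    rest-0 u v φ = laplace-0 1 (u ∘ suc) (λ j → 0#) (λ j → refl)

  -- For equal rows the two contributions through column zero cancel, and `rest` is the same double
  -- expansion with column zero deleted, so induction applies.
  two-rows-alternating : ∀ n u φ → Respects φ → two-rows n u u φ ≈ 0#
  two-rows-alternating n u φ φ-cong = begin
    two-rows n u u φ
      ≈⟨ two-rows-split n u u φ ⟩
    rest n u u φ + (u zero * edge n u φ + (- 1#) * (u zero * edge n u φ))
      ≈⟨ +-cong (rest≈0 n u φ φ-cong) (trans (+-comm _ _) (-1*x+x≈0 _)) ⟩
    0# + 0#
      ≈⟨ +-identityʳ 0# ⟩
    0# ∎
    where
    rest≈0 : ∀ n u φ → Respects φ → rest n u u φ ≈ 0#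
    rest≈0 zero    u φ φ-cong = rest-0 u u φ
    rest≈0 (suc n) u φ φ-cong = trans (rest-suc n u u φ φ-cong)
      (two-rows-alternating n (u ∘ suc) (φ ∘ lift) (φ-cong ∘ lift-cong))

  two-rows-antisym : ∀ n u v φ → Respects φ → two-rows n u v φ + two-rows n v u φ ≈ 0#
  two-rows-antisym n u v φ φ-cong = begin
    two-rows n u v φ + two-rows n v u φ
      ≈⟨ +-cong (two-rows-split n u v φ) (two-rows-split n v u φ) ⟩
    (rest n u v φ + (a + (- 1#) * b)) + (rest n v u φ + (b + (- 1#) * a))
      ≈⟨ solve 5 (λ r s a b m → (r :+ (a :+ m :* b)) :+ (s :+ (b :+ m :* a))
           := (r :+ s) :+ (m :* (a :+ b) :+ (a :+ b))) refl _ _ _ _ _ ⟩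
    (rest n u v φ + rest n v u φ) + ((- 1#) * (a + b) + (a + b))
      ≈⟨ +-cong (rest+rest≈0 n u v φ φ-cong) (-1*x+x≈0 _) ⟩
    0# + 0#
      ≈⟨ +-identityʳ 0# ⟩
    0# ∎
    where
    a b : Carrier
    a = u zero * edge n v φ
    b = v zero * edge n u φ
    rest+rest≈0 : ∀ n u v φ → Respects φ → rest n u v φ + rest n v u φ ≈ 0#
    rest+rest≈0 zero    u v φ φ-cong =
      trans (+-cong (rest-0 u v φ) (rest-0 v u φ)) (+-identityʳ 0#)
    rest+rest≈0 (suc n) u v φ φ-cong =
      trans (+-cong (rest-suc n u v φ φ-cong) (rest-suc n v u φ φ-cong))
        (two-rows-antisym n (u ∘ suc) (v ∘ suc) (φ ∘ lift) (φ-cong ∘ lift-cong))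

  det-alternating : ∀ n (u : Row (suc (suc n))) h → det (suc (suc n)) (u ∷ u ∷ h) ≈ 0#
  det-alternating n u h = two-rows-alternating n u (λ f → det n (λ a b → h a (f b)))
    λ e → det-cong n _ _ (λ a b → reflexive (≡.cong (h a) (e b)))

  det-antisym : ∀ n (u v : Row (suc (suc n))) h →
                det (suc (suc n)) (u ∷ v ∷ h) + det (suc (suc n)) (v ∷ u ∷ h) ≈ 0#
  det-antisym n u v h = two-rows-antisym n u v (λ f → det n (λ a b → h a (f b)))
    λ e → det-cong n _ _ (λ a b → reflexive (≡.cong (h a) (e b)))

  det-linear₀ : ∀ n a (u v w : Row (suc n)) h → (∀ j → w j ≈ u j + a * v j) →
                det (suc n) (w ∷ h) ≈ det (suc n) (u ∷ h) + a * det (suc n) (v ∷ h)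
  det-linear₀ n a u v w h e = Σ-linear (suc n) a
    (λ j → sgn j * (u j * D j)) (λ j → sgn j * (v j * D j)) (λ j → sgn j * (w j * D j)) λ j →
    trans (*-congˡ (*-congʳ (e j)))
      (solve 5 (λ s u a v d → s :* ((u :+ a :* v) :* d) := s :* (u :* d) :+ a :* (s :* (v :* d)))
        refl (sgn j) (u j) a (v j) (D j))
    where
    D : Fin (suc n) → Carrier
    D j = det n (λ i → h i ∘ punchIn j)

  det-linear₁ : ∀ n a (t u v w : Row (suc (suc n))) h → (∀ j → w j ≈ u j + a * v j) →
                det (suc (suc n)) (t ∷ w ∷ h) ≈
                det (suc (suc n)) (t ∷ u ∷ h) + a * det (suc (suc n)) (t ∷ v ∷ h)
  det-linear₁ n a t u v w h e = Σ-linear (suc (suc n)) a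
    (λ j → sgn j * (t j * D u j)) (λ j → sgn j * (t j * D v j)) (λ j → sgn j * (t j * D w j)) λ j →
    trans (*-congˡ (*-congˡ (det-linear₀ n a (u ∘ punchIn j) (v ∘ punchIn j) (w ∘ punchIn j)
             (λ i → h i ∘ punchIn j) (e ∘ punchIn j))))
      (solve 5 (λ s t x a y → s :* (t :* (x :+ a :* y)) := s :* (t :* x) :+ a :* (s :* (t :* y)))
        refl (sgn j) (t j) (D u j) a (D v j))
    where
    D : Row (suc (suc n)) → Fin (suc (suc n)) → Carrier
    D v j = det (suc n) (λ i → (v ∷ h) i ∘ punchIn j)

  det-scale₀ : ∀ n a (u : Row (suc n)) h →
               a * det (suc n) (u ∷ h) ≈ det (suc n) ((λ j → a * u j) ∷ h)
  det-scale₀ n a u h = trans (*-Σ (suc n) a (λ j → sgn j * (u j * D j)))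
    (Σ-cong (suc n) {g = λ j → sgn j * ((a * u j) * D j)} λ j →
      solve 4 (λ a s u d → a :* (s :* (u :* d)) := s :* ((a :* u) :* d)) refl a (sgn j) (u j) (D j))
    where
    D : Fin (suc n) → Carrier
    D j = det n (λ i → h i ∘ punchIn j)

  -- Linearity and alternation clear the row `h zero`. For the rows below it the first two rows are
  -- exchanged: expanding along `h zero` then leaves minors with v on top, where induction applies.
  det-shear : ∀ n (v : Row (suc n)) (h : Fin n → Row (suc n)) (λs : Fin n → Carrier) →
              det (suc n) (v ∷ λ i j → h i j + λs i * v j) ≈ det (suc n) (v ∷ h)
  det-shear zero    v h λs = refl
  det-shear (suc n) v h λs = +-cancelʳ (begin
    det₂ (v ∷ h⁺) + det₂ (h zero ∷ v ∷ h ∘ suc)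
      ≈⟨ +-congʳ (det-∷-η n v h⁺) ⟩
    det₂ (v ∷ h⁺ zero ∷ h⁺ ∘ suc) + det₂ (h zero ∷ v ∷ h ∘ suc)
      ≈⟨ +-cong (det-linear₁ n (λs zero) v (h zero) v (h⁺ zero) (h⁺ ∘ suc) (λ j → refl))
           (sym minors) ⟩
    (det₂ (v ∷ h zero ∷ h⁺ ∘ suc) + λs zero * det₂ (v ∷ v ∷ h⁺ ∘ suc))
      + det₂ (h zero ∷ v ∷ h⁺ ∘ suc)
      ≈⟨ +-congʳ (trans (+-congˡ (trans (*-congˡ (det-alternating n v (h⁺ ∘ suc))) (zeroʳ (λs zero))))
           (+-identityʳ _)) ⟩
    det₂ (v ∷ h zero ∷ h⁺ ∘ suc) + det₂ (h zero ∷ v ∷ h⁺ ∘ suc)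
      ≈⟨ det-antisym n v (h zero) (h⁺ ∘ suc) ⟩
    0#
      ≈⟨ sym (det-antisym n v (h zero) (h ∘ suc)) ⟩
    det₂ (v ∷ h zero ∷ h ∘ suc) + det₂ (h zero ∷ v ∷ h ∘ suc)
      ≈⟨ +-congʳ (sym (det-∷-η n v h)) ⟩
    det₂ (v ∷ h) + det₂ (h zero ∷ v ∷ h ∘ suc) ∎)
    where
    det₂ : (Fin (suc (suc n)) → Row (suc (suc n))) → Carrier
    det₂ = det (suc (suc n))
    h⁺ : Fin (suc n) → Row (suc (suc n))
    h⁺ i j = h i j + λs i * v j
    minors : det₂ (h zero ∷ v ∷ h⁺ ∘ suc) ≈ det₂ (h zero ∷ v ∷ h ∘ suc)
    minors = laplace-cong (suc (suc n)) (h zero) (h zero) _ _ (λ j → refl) λ j → begin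
      det (suc n) (λ a b → (v ∷ h⁺ ∘ suc) a (punchIn j b))
        ≈⟨ minor-∷ n v (h⁺ ∘ suc) j ⟩
      det (suc n) (v ∘ punchIn j ∷ λ a b → h (suc a) (punchIn j b) + λs (suc a) * v (punchIn j b))
        ≈⟨ det-shear n (v ∘ punchIn j) (λ a → h (suc a) ∘ punchIn j) (λs ∘ suc) ⟩
      det (suc n) (v ∘ punchIn j ∷ λ a → h (suc a) ∘ punchIn j)
        ≈⟨ sym (minor-∷ n v (h ∘ suc) j) ⟩
      det (suc n) (λ a b → (v ∷ h ∘ suc) a (punchIn j b)) ∎

  -- Row 0 of the product is row 0 of M. Each lower row is a row of a smaller product plus
  -- `L (suc i) zero` times row 0 of M, which `det-shear` removes; the remaining minors are again
  -- products with a unitriangular left factor.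
  det-unitriangular-* : ∀ n (L M : Fin n → Row n) →
    (∀ i → L i i ≈ 1#) → (∀ i j → toℕ i ℕ.< toℕ j → L i j ≈ 0#) →
    det n (λ i j → Σ n λ l → L i l * M l j) ≈ det n M
  det-unitriangular-* zero    L M diag upper = refl
  det-unitriangular-* (suc n) L M diag upper = begin
    det (suc n) (λ i j → Σ (suc n) λ l → L i l * M l j)
      ≈⟨ det-cong (suc n) (λ i j → Σ (suc n) λ l → L i l * M l j)
           (M zero ∷ λ i j → N i j + L (suc i) zero * M zero j)
           (λ { zero j → row₀ j ; (suc i) j → +-comm _ _ }) ⟩
    det (suc n) (M zero ∷ λ i j → N i j + L (suc i) zero * M zero j)
      ≈⟨ det-shear n (M zero) N (λ i → L (suc i) zero) ⟩
    det (suc n) (M zero ∷ N)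
      ≈⟨ laplace-cong (suc n) (M zero) (M zero) _ _ (λ j → refl) (λ j →
           det-unitriangular-* n (λ i l → L (suc i) (suc l)) (minor M j)
             (diag ∘ suc) (λ i l i<l → upper (suc i) (suc l) (s≤s i<l))) ⟩
    det (suc n) M ∎
    where
    N : Fin n → Row (suc n)
    N i j = Σ n λ l → L (suc i) (suc l) * M (suc l) j
    row₀ : ∀ j → L zero zero * M zero j + Σ n (λ l → L zero (suc l) * M (suc l) j) ≈ M zero j
    row₀ j = trans
      (+-cong (trans (*-congʳ (diag zero)) (*-identityˡ _))
        (Σ-0 n λ l → trans (*-congʳ (upper zero (suc l) (s≤s z≤n))) (zeroˡ _)))
      (+-identityʳ _)

  -- The three facts are proved together by induction on the size. Deleting a column `suc j` keeps
  -- column zero in place, so if that column vanishes below the top, each such minor has a zero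
  -- column and only the term j = `zero` survives.
  det-zero-column : ∀ n (M : Fin (suc n) → Row (suc n)) → (∀ i → M i zero ≈ 0#) →
                    det (suc n) M ≈ 0#
  minors-zero-column : ∀ n (M : Fin (suc n) → Row (suc n)) → (∀ i → M (suc i) zero ≈ 0#) →
                       ∀ j → det n (minor M (suc j)) ≈ 0#
  det-first-column : ∀ n (M : Fin (suc n) → Row (suc n)) → (∀ i → M (suc i) zero ≈ 0#) →
                     det (suc n) M ≈ M zero zero * det n (minor M zero)

  det-zero-column n M e =
    trans (det-first-column n M (e ∘ suc)) (trans (*-congʳ (e zero)) (zeroˡ _))

  minors-zero-column (suc n) M e j = det-zero-column n (minor M (suc j)) e

  det-first-column n M e = trans
    (+-cong (*-identityˡ _) (Σ-0 n λ j →
      trans (*-congˡ (trans (*-congˡ (minors-zero-column n M e j)) (zeroʳ _))) (zeroʳ _)))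
    (+-identityʳ _)

  -- The lower rows b of an upper Hessenberg matrix are eliminated from its first row w
  -- by the multipliers κ (suc a) * f a; the sequence κ absorbs the pivots.
  det-Hessenberg : ∀ n (w : ℕ → Carrier) (b : ℕ → ℕ → Carrier) (κ f : ℕ → Carrier) →
    (∀ a t → t ℕ.< a → b a t ≈ 0#) →
    (∀ t → κ (suc t) * ((- 1#) * b t t) ≈ κ t) →
    (∀ t → w t + Σ (suc t) (λ a → (κ (suc (toℕ a)) * f (toℕ a)) * b (toℕ a) t) ≈ 0#) →
    det (suc n) ((w ∘ toℕ) ∷ λ a j → b (toℕ a) (toℕ j)) ≈ κ 0 * f n
  det-Hessenberg n w b κ f upper pivot kernel = go n
    where
    w₀ : w 0 ≈ ((- 1#) * b 0 0) * (κ 1 * f 0)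
    w₀ = +-cancelʳ (trans (trans (+-congˡ (sym (+-identityʳ _))) (kernel 0))
      (sym (trans (+-congʳ (solve 3 (λ m b k → (m :* b) :* k := m :* (k :* b)) refl _ _ _))
        (-1*x+x≈0 ((κ 1 * f 0) * b 0 0)))))
    absorb : ∀ y → ((- 1#) * b 0 0) * (κ 1 * y) ≈ κ 0 * y
    absorb y = trans (solve 3 (λ p k y → p :* (k :* y) := (k :* p) :* y) refl _ _ _)
      (*-congʳ (pivot 0))
    go : ∀ n → det (suc n) ((w ∘ toℕ) ∷ λ a j → b (toℕ a) (toℕ j)) ≈ κ 0 * f n
    go zero    = begin
      1# * (w 0 * 1#) + 0#             ≈⟨ solve 1 (λ w → con 1 :* (w :* con 1) :+ con 0 := w) refl (w 0) ⟩
      w 0                              ≈⟨ w₀ ⟩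
      ((- 1#) * b 0 0) * (κ 1 * f 0)   ≈⟨ absorb (f 0) ⟩
      κ 0 * f 0                        ∎
    go (suc n) = begin
      D ((w ∘ toℕ) ∷ b′)
        ≈⟨ det-∷-η n (w ∘ toℕ) b′ ⟩
      D ((w ∘ toℕ) ∷ b₀ ∷ b₊)
        ≈⟨ sym (trans (+-congˡ (trans (*-congˡ (det-alternating n b₀ b₊)) (zeroʳ k₀))) (+-identityʳ _)) ⟩
      D ((w ∘ toℕ) ∷ b₀ ∷ b₊) + k₀ * D (b₀ ∷ b₀ ∷ b₊)
        ≈⟨ sym (det-linear₀ (suc n) k₀ (w ∘ toℕ) b₀ (w⁺ ∘ toℕ) (b₀ ∷ b₊) (λ j → refl)) ⟩
      D ((w⁺ ∘ toℕ) ∷ b₀ ∷ b₊)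
        ≈⟨ +-cancelʳ (trans (det-antisym n (w⁺ ∘ toℕ) b₀ b₊) (sym (-1*x+x≈0 _))) ⟩
      (- 1#) * D (b₀ ∷ (w⁺ ∘ toℕ) ∷ b₊)
        -- By `kernel 0` the row `w⁺` starts with zero, so after the exchange column zero contains
        -- only the pivot `b 0 0`.
        ≈⟨ *-congˡ (det-first-column (suc n) (b₀ ∷ (w⁺ ∘ toℕ) ∷ b₊)
             (λ { zero → trans (+-congˡ (sym (+-identityʳ _))) (kernel 0)
                ; (suc i) → upper (suc (toℕ i)) 0 (s≤s z≤n) })) ⟩
      (- 1#) * (b 0 0 * det (suc n) (λ i j → ((w⁺ ∘ toℕ) ∷ b₊) i (suc j)))
        ≈⟨ sym (*-assoc _ _ _) ⟩
      ((- 1#) * b 0 0) * det (suc n) (λ i j → ((w⁺ ∘ toℕ) ∷ b₊) i (suc j))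
        ≈⟨ *-congˡ (det-cong (suc n) (λ i j → ((w⁺ ∘ toℕ) ∷ b₊) i (suc j))
             ((w⁺ ∘ suc ∘ toℕ) ∷ λ a j → b (suc (toℕ a)) (suc (toℕ j)))
             (λ { zero j → refl ; (suc i) j → refl })) ⟩
      ((- 1#) * b 0 0) * det (suc n) ((w⁺ ∘ suc ∘ toℕ) ∷ λ a j → b (suc (toℕ a)) (suc (toℕ j)))
        -- The hypotheses survive the shift because `w⁺` has already absorbed the a = 0 summand of
        -- the kernel relation.
        ≈⟨ *-congˡ (det-Hessenberg n (w⁺ ∘ suc) (λ a t → b (suc a) (suc t)) (κ ∘ suc) (f ∘ suc)
             (λ a t t<a → upper (suc a) (suc t) (s≤s t<a)) (pivot ∘ suc)
             (λ t → trans (+-assoc _ _ _) (kernel (suc t)))) ⟩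
      ((- 1#) * b 0 0) * (κ 1 * f (suc n))
        ≈⟨ absorb (f (suc n)) ⟩
      κ 0 * f (suc n) ∎
      where
      D : (Fin (suc (suc n)) → Row (suc (suc n))) → Carrier
      D = det (suc (suc n))
      b′ : Fin (suc n) → Row (suc (suc n))
      b′ a j = b (toℕ a) (toℕ j)
      b₀ : Row (suc (suc n))
      b₀ = b′ zero
      b₊ : Fin n → Row (suc (suc n))
      b₊ = b′ ∘ suc
      k₀ : Carrier
      k₀ = κ 1 * f 0
      w⁺ : ℕ → Carrier
      w⁺ t = w t + k₀ * b 0 t

-- Integer powers of q and q-binomials with integer upper index

module QBinomials {c ℓ : Level} (R : CommutativeRing c ℓ)
  (q qi : CommutativeRing.Carrier R)
  (q-inverse : CommutativeRing._≈_ R (CommutativeRing._*_ R q qi) (CommutativeRing.1# R)) where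
  open CommutativeRing R hiding (zero)
  open WithRing R
  open Sums R
  open Algebra.Solver.Ring.NaturalCoefficients.Default commutativeSemiring
  open Relation.Binary.Reasoning.Setoid setoid

  infix 9 q^_
  q^_ : ℤ → Carrier
  q^ (+ n)    = q ^ n
  q^ -[1+ n ] = qi ^ suc n

  q^-cong : ∀ {i j} → i ≡ j → q^ i ≈ q^ j
  q^-cong e = reflexive (≡.cong q^_ e)

  q^-suc : ∀ i → q^ (+ 1 ℤ.+ i) ≈ q * q^ i
  q^-suc (+ n)          = refl
  q^-suc -[1+ zero ]    = sym (trans (*-congˡ (*-identityʳ qi)) q-inverse)
  q^-suc -[1+ suc n ]   = begin
    qi ^ suc n               ≈⟨ sym (*-identityˡ _) ⟩
    1# * qi ^ suc n          ≈⟨ *-congʳ (sym q-inverse) ⟩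
    (q * qi) * qi ^ suc n    ≈⟨ *-assoc _ _ _ ⟩
    q * qi ^ suc (suc n)     ∎

  q^-pred : ∀ i → q^ (-[1+ 0 ] ℤ.+ i) ≈ qi * q^ i
  q^-pred i = begin
    q^ (-[1+ 0 ] ℤ.+ i)                      ≈⟨ sym (*-identityˡ _) ⟩
    1# * q^ (-[1+ 0 ] ℤ.+ i)                 ≈⟨ *-congʳ (sym q-inverse) ⟩
    (q * qi) * q^ (-[1+ 0 ] ℤ.+ i)           ≈⟨ solve 3 (λ a b x → (a :* b) :* x := b :* (a :* x)) refl _ _ _ ⟩
    qi * (q * q^ (-[1+ 0 ] ℤ.+ i))           ≈⟨ *-congˡ (sym (q^-suc (-[1+ 0 ] ℤ.+ i))) ⟩
    qi * q^ (+ 1 ℤ.+ (-[1+ 0 ] ℤ.+ i))       ≈⟨ *-congˡ (q^-cong (e i)) ⟩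
    qi * q^ i                                ∎
    where
    e : ∀ i → + 1 ℤ.+ (-[1+ 0 ] ℤ.+ i) ≡ i
    e = solve-∀

  q^-+ : ∀ i j → q^ (i ℤ.+ j) ≈ q^ i * q^ j
  q^-+ (+ zero)  j = trans (q^-cong (ℤ.+-identityˡ j)) (sym (*-identityˡ _))
  q^-+ (+ suc n) j = begin
    q^ (+ suc n ℤ.+ j)          ≈⟨ q^-cong (ℤ.+-assoc (+ 1) (+ n) j) ⟩
    q^ (+ 1 ℤ.+ (+ n ℤ.+ j))    ≈⟨ q^-suc (+ n ℤ.+ j) ⟩
    q * q^ (+ n ℤ.+ j)          ≈⟨ *-congˡ (q^-+ (+ n) j) ⟩
    q * (q ^ n * q^ j)          ≈⟨ sym (*-assoc _ _ _) ⟩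
    q ^ suc n * q^ j            ∎
  q^-+ -[1+ zero ] j = trans (q^-pred j) (*-congʳ (sym (*-identityʳ qi)))
  q^-+ -[1+ suc n ] j = begin
    q^ (-[1+ suc n ] ℤ.+ j)             ≈⟨ q^-cong (ℤ.+-assoc -[1+ 0 ] -[1+ n ] j) ⟩
    q^ (-[1+ 0 ] ℤ.+ (-[1+ n ] ℤ.+ j))  ≈⟨ q^-pred (-[1+ n ] ℤ.+ j) ⟩
    qi * q^ (-[1+ n ] ℤ.+ j)            ≈⟨ *-congˡ (q^-+ -[1+ n ] j) ⟩
    qi * (q^ -[1+ n ] * q^ j)           ≈⟨ sym (*-assoc _ _ _) ⟩
    q^ -[1+ suc n ] * q^ j              ∎

  q^-combine : ∀ i j k → i ℤ.+ j ≡ k → q^ i * q^ j ≈ q^ k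
  q^-combine i j k e = trans (sym (q^-+ i j)) (q^-cong e)

  gauss-zero : ∀ a m → a ℕ.< m → gauss q a m ≈ 0#
  gauss-zero zero    (suc m) _         = refl
  gauss-zero (suc a) (suc m) (s≤s a<m) = trans
    (+-cong (gauss-zero a m a<m) (trans (*-congˡ (gauss-zero a (suc m) (ℕ.m<n⇒m<1+n a<m))) (zeroʳ _)))
    (+-identityʳ 0#)

  gauss-m-0 : ∀ a → gauss q a 0 ≈ 1#
  gauss-m-0 zero    = refl
  gauss-m-0 (suc a) = refl

  gauss-diag : ∀ a → gauss q a a ≈ 1#
  gauss-diag zero    = refl
  gauss-diag (suc a) = trans
    (+-cong (gauss-diag a) (trans (*-congˡ (gauss-zero a (suc a) (ℕ.n<1+n a))) (zeroʳ _)))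
    (+-identityʳ 1#)

  -- The Pascal rule dual to the one that defines `gauss`. The integer exponent lets the induction
  -- use q * q^(a-m-1) = q^(a-m) with no case split on a ≤ m.
  gauss-pascal : ∀ a m → gauss q (suc a) (suc m) ≈
                         q^ (+ a ℤ.- + m) * gauss q a m + gauss q a (suc m)
  gauss-pascal zero zero    = trans (+-congˡ (zeroʳ _)) (+-congʳ (sym (*-identityˡ _)))
  gauss-pascal zero (suc m) = +-cong (sym (zeroʳ _)) (zeroʳ _)
  gauss-pascal (suc a) zero = begin
    1# + (q * 1#) * gauss q (suc a) 1
      ≈⟨ +-congˡ (*-congˡ (trans (gauss-pascal a 0) (+-congʳ (*-cong (q^-cong (ℤ.+-identityʳ (+ a))) (gauss-m-0 a))))) ⟩
    1# + (q * 1#) * (q ^ a * 1# + gauss q a 1)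
      ≈⟨ solve 3 (λ q p g → con 1 :+ (q :* con 1) :* (p :* con 1 :+ g)
           := (q :* p) :* con 1 :+ (con 1 :+ (q :* con 1) :* g)) refl q (q ^ a) (gauss q a 1) ⟩
    q ^ suc a * 1# + (1# + (q * 1#) * gauss q a 1)
      ≈⟨ +-cong (*-congʳ (q^-cong (≡.sym (ℤ.+-identityʳ (+ suc a))))) (+-congʳ (sym (gauss-m-0 a))) ⟩
    q^ (+ suc a ℤ.- + 0) * 1# + gauss q (suc a) 1 ∎
  gauss-pascal (suc a) (suc m) = begin
    gauss q (suc a) (suc m) + (q * (q * q ^ m)) * gauss q (suc a) (suc (suc m))
      ≈⟨ +-cong (gauss-pascal a m) (*-congˡ (gauss-pascal a (suc m))) ⟩
    (P * g₀ + g₁) + (q * (q * q ^ m)) * (q^ (+ a ℤ.- + suc m) * g₁ + g₂)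
      ≈⟨ solve 7 (λ p g₀ g₁ g₂ q r d → (p :* g₀ :+ g₁) :+ (q :* (q :* r)) :* (d :* g₁ :+ g₂)
           := (p :* g₀ :+ (q :* r) :* ((q :* d) :* g₁)) :+ (g₁ :+ (q :* (q :* r)) :* g₂))
           refl P g₀ g₁ g₂ q (q ^ m) (q^ (+ a ℤ.- + suc m)) ⟩
    (P * g₀ + (q * q ^ m) * ((q * q^ (+ a ℤ.- + suc m)) * g₁)) + gauss q (suc a) (suc (suc m))
      ≈⟨ +-congʳ (+-congˡ (*-congˡ (*-congʳ (trans (sym (q^-suc (+ a ℤ.- + suc m))) (q^-cong (e₁ (+ a) (+ m))))))) ⟩
    (P * g₀ + (q * q ^ m) * (P * g₁)) + gauss q (suc a) (suc (suc m))
      ≈⟨ +-congʳ (solve 4 (λ p r g₀ g₁ → p :* g₀ :+ r :* (p :* g₁) := p :* (g₀ :+ r :* g₁)) refl _ _ _ _) ⟩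
    P * gauss q (suc a) (suc m) + gauss q (suc a) (suc (suc m))
      ≈⟨ +-congʳ (*-congʳ (q^-cong (e₂ (+ a) (+ m)))) ⟩
    q^ (+ suc a ℤ.- + suc m) * gauss q (suc a) (suc m) + gauss q (suc a) (suc (suc m)) ∎
    where
    P g₀ g₁ g₂ : Carrier
    P = q^ (+ a ℤ.- + m)
    g₀ = gauss q a m
    g₁ = gauss q a (suc m)
    g₂ = gauss q a (suc (suc m))
    e₁ : ∀ a m → + 1 ℤ.+ (a ℤ.- (+ 1 ℤ.+ m)) ≡ a ℤ.- m
    e₁ = solve-∀
    e₂ : ∀ a m → a ℤ.- m ≡ (+ 1 ℤ.+ a) ℤ.- (+ 1 ℤ.+ m)
    e₂ = solve-∀

  qi^≈q^- : ∀ n → qi ^ n ≈ q^ (ℤ.- + n)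
  qi^≈q^- zero    = refl
  qi^≈q^- (suc n) = refl

  qbinom-m-0 : ∀ a → qbinom q qi a 0 ≈ 1#
  qbinom-m-0 (+ a)    = gauss-m-0 a
  qbinom-m-0 -[1+ b ] = begin
    1# * (qi ^ (suc b ℕ.* 0 ℕ.+ 0) * gauss q (b ℕ.+ 0) 0)
      ≈⟨ *-congˡ (*-cong (reflexive (≡.cong (qi ^_) (≡.trans (ℕ.+-identityʳ _) (ℕ.*-zeroʳ b)))) (gauss-m-0 (b ℕ.+ 0))) ⟩
    1# * (1# * 1#)
      ≈⟨ trans (*-identityˡ _) (*-identityˡ _) ⟩
    1# ∎

  private
    exponent : ∀ b m → ℤ.- + (b ℕ.* m ℕ.+ tri m) ≡ ℤ.- (+ b ℤ.* + m ℤ.+ + tri m)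
    exponent b m = ≡.cong (λ z → ℤ.- (z ℤ.+ + tri m)) (ℤ.pos-* b m)

    -- Unlike in the definition, b = 0 is allowed: both sides vanish then.
    qbinom-neg : ∀ b m → qbinom q qi (ℤ.- + b) (suc m) ≈
      (- 1#) ^ suc m * (q^ (ℤ.- (+ b ℤ.* + suc m ℤ.+ + tri (suc m))) * gauss q (b ℕ.+ m) (suc m))
    qbinom-neg zero    m = sym (trans (*-congˡ (trans (*-congˡ (gauss-zero m (suc m) (ℕ.n<1+n m))) (zeroʳ _))) (zeroʳ _))
    qbinom-neg (suc b) m = *-congˡ (*-cong
      (trans (qi^≈q^- (suc b ℕ.* suc m ℕ.+ tri (suc m))) (q^-cong (exponent (suc b) (suc m))))
      (reflexive (≡.cong (λ a → gauss q a (suc m)) (ℕ.+-suc b m))))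

    suc-neg : ∀ b → -[1+ b ] ℤ.+ + 1 ≡ ℤ.- + b
    suc-neg zero    = ≡.refl
    suc-neg (suc b) = ≡.refl

  -- For a = -(b+1) the reflection formula turns this into the defining recurrence of
  -- `gauss q (b + suc m) (suc m)`, with its terms moved across the equation.
  qbinom-pascal : ∀ a m → qbinom q qi (a ℤ.+ + 1) (suc m) ≈
                          q^ (a ℤ.- + m) * qbinom q qi a m + qbinom q qi a (suc m)
  qbinom-pascal (+ a)    m = trans
    (reflexive (≡.cong (λ n → gauss q n (suc m)) (ℕ.+-comm a 1))) (gauss-pascal a m)
  qbinom-pascal -[1+ b ] m = begin
    qbinom q qi (-[1+ b ] ℤ.+ + 1) (suc m)
      ≈⟨ reflexive (≡.cong (λ z → qbinom q qi z (suc m)) (suc-neg b)) ⟩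
    qbinom q qi (ℤ.- + b) (suc m)
      ≈⟨ qbinom-neg b m ⟩
    ((- 1#) * s) * (q^ E₁ * g₁)
      ≈⟨ *-congˡ (*-congʳ (sym (q^-combine (+ suc m) E E₁ (e₁ (+ b) (+ m) (+ tri m))))) ⟩
    ((- 1#) * s) * ((q ^ suc m * q^ E) * g₁)
      -- Both sides become zero once s * q^(m+1) * q^E * g₁ is added.
      ≈⟨ +-cancelʳ cancel ⟩
    s * (q^ E * g₀) + ((- 1#) * s) * (q^ E * (g₀ + q ^ suc m * g₁))
      ≈⟨ +-congʳ (*-congˡ (*-congʳ (sym (q^-combine (-[1+ b ] ℤ.- + m) E₀ E (e₀ (+ b) (+ m) (+ tri m)))))) ⟩
    s * ((q^ (-[1+ b ] ℤ.- + m) * q^ E₀) * g₀) + ((- 1#) * s) * (q^ E * (g₀ + q ^ suc m * g₁))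
      ≈⟨ +-cong (solve 4 (λ s x y g → s :* ((x :* y) :* g) := x :* (s :* (y :* g))) refl _ _ _ _)
           (reflexive (≡.cong (λ n → ((- 1#) * s) * (q^ E * gauss q n (suc m))) (≡.sym (ℕ.+-suc b m)))) ⟩
    q^ (-[1+ b ] ℤ.- + m) * (s * (q^ E₀ * g₀)) + ((- 1#) * s) * (q^ E * gauss q (b ℕ.+ suc m) (suc m))
      ≈⟨ sym (+-cong (*-congˡ (*-congˡ (*-congʳ (trans (qi^≈q^- (suc b ℕ.* m ℕ.+ tri m)) (q^-cong (exponent (suc b) m))))))
           (*-congˡ (*-congʳ (trans (qi^≈q^- (suc b ℕ.* suc m ℕ.+ tri (suc m))) (q^-cong (exponent (suc b) (suc m))))))) ⟩
    q^ (-[1+ b ] ℤ.- + m) * qbinom q qi -[1+ b ] m + qbinom q qi -[1+ b ] (suc m) ∎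
    where
    s g₀ g₁ : Carrier
    s = (- 1#) ^ m
    g₀ = gauss q (b ℕ.+ m) m
    g₁ = gauss q (b ℕ.+ m) (suc m)
    E E₀ E₁ : ℤ
    E  = ℤ.- (+ suc b ℤ.* + suc m ℤ.+ + tri (suc m))
    E₀ = ℤ.- (+ suc b ℤ.* + m ℤ.+ + tri m)
    E₁ = ℤ.- (+ b ℤ.* + suc m ℤ.+ + tri (suc m))
    e₀ : ∀ b m t → (ℤ.- (+ 1 ℤ.+ b) ℤ.- m) ℤ.+ ℤ.- ((+ 1 ℤ.+ b) ℤ.* m ℤ.+ t) ≡
         ℤ.- ((+ 1 ℤ.+ b) ℤ.* (+ 1 ℤ.+ m) ℤ.+ (m ℤ.+ t))
    e₀ = solve-∀
    e₁ : ∀ b m t → (+ 1 ℤ.+ m) ℤ.+ ℤ.- ((+ 1 ℤ.+ b) ℤ.* (+ 1 ℤ.+ m) ℤ.+ (m ℤ.+ t)) ≡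
         ℤ.- (b ℤ.* (+ 1 ℤ.+ m) ℤ.+ (m ℤ.+ t))
    e₁ = solve-∀
    cancel : ((- 1#) * s) * ((q ^ suc m * q^ E) * g₁) + s * ((q ^ suc m * q^ E) * g₁) ≈
             (s * (q^ E * g₀) + ((- 1#) * s) * (q^ E * (g₀ + q ^ suc m * g₁)))
               + s * ((q ^ suc m * q^ E) * g₁)
    cancel = begin
      ((- 1#) * s) * ((q ^ suc m * q^ E) * g₁) + s * ((q ^ suc m * q^ E) * g₁)
        ≈⟨ trans (+-congʳ (*-assoc _ _ _)) (-1*x+x≈0 _) ⟩
      0#
        ≈⟨ sym (-1*x+x≈0 _) ⟩
      (- 1#) * (s * (q^ E * (g₀ + q ^ suc m * g₁))) + s * (q^ E * (g₀ + q ^ suc m * g₁))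
        ≈⟨ solve 6 (λ m s e g h r → m :* (s :* (e :* (g :+ r :* h))) :+ s :* (e :* (g :+ r :* h))
             := (s :* (e :* g) :+ (m :* s) :* (e :* (g :+ r :* h))) :+ s :* ((r :* e) :* h))
             refl (- 1#) s (q^ E) g₀ g₁ (q ^ suc m) ⟩
      (s * (q^ E * g₀) + ((- 1#) * s) * (q^ E * (g₀ + q ^ suc m * g₁)))
        + s * ((q ^ suc m * q^ E) * g₁) ∎

  -- Extension by zero to negative lower indices makes the Pascal rule hold at d = 0 as well, and
  -- lets sums run past their natural ends.
  binom : ℤ → ℤ → Carrier
  binom a (+ m)    = qbinom q qi a m
  binom a -[1+ m ] = 0#

  binom-pascal : ∀ a d → binom (a ℤ.+ + 1) d ≈ q^ (a ℤ.- d ℤ.+ + 1) * binom a (d ℤ.- + 1) + binom a d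
  binom-pascal a (+ suc m) = trans (qbinom-pascal a m) (+-congʳ (*-congʳ (q^-cong (e a (+ m)))))
    where
    e : ∀ a m → a ℤ.- m ≡ a ℤ.- (+ 1 ℤ.+ m) ℤ.+ + 1
    e = solve-∀
  binom-pascal a (+ zero)  = trans (qbinom-m-0 (a ℤ.+ + 1))
    (sym (trans (+-cong (zeroʳ _) (qbinom-m-0 a)) (+-identityˡ 1#)))
  binom-pascal a -[1+ m ]  = sym (trans (+-identityʳ _) (zeroʳ _))

  -- T l i is the l-th q-difference of the sequence T 0 at i.
  q-Newton : ∀ (T : ℕ → ℕ → Carrier) →
    (∀ l i → T l (suc i) ≈ T (suc l) i + q ^ l * T l i) →
    ∀ N i p → i ℕ.< N → Σ N (λ l → gauss q i (toℕ l) * T (toℕ l) p) ≈ T 0 (i ℕ.+ p)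
  q-Newton T diff (suc N) zero p _ = begin
    1# * T 0 p + Σ N (λ l → 0# * T (suc (toℕ l)) p)  ≈⟨ +-cong (*-identityˡ _) (Σ-0 N λ l → zeroˡ _) ⟩
    T 0 p + 0#                                       ≈⟨ +-identityʳ _ ⟩
    T 0 p                                            ∎
  q-Newton T diff (suc N) (suc i) p (s≤s i<N) = begin
    1# * T 0 p + Σ N (λ l → gauss q (suc i) (suc (toℕ l)) * T (suc (toℕ l)) p)
      ≈⟨ +-cong (*-congʳ (sym (trans (*-identityˡ _) (gauss-m-0 i))))
           (trans (Σ-cong N λ l → solve 4 (λ g h r t → (g :+ r :* h) :* t := g :* t :+ (r :* h) :* t) refl _ _ _ _)
             (Σ-+ N (A ∘ toℕ) (B ∘ suc ∘ toℕ))) ⟩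
    B 0 + (Σ N (A ∘ toℕ) + Σ N (B ∘ suc ∘ toℕ))
      ≈⟨ solve 3 (λ b x y → b :+ (x :+ y) := x :+ (b :+ y)) refl _ _ _ ⟩
    Σ N (A ∘ toℕ) + Σ (suc N) (B ∘ toℕ)
      -- Since i < N, the term of `A` at N vanishes and both sums can be given the same range.
      ≈⟨ +-congʳ (sym (trans (Σ-last N A)
           (trans (+-congˡ (trans (*-congʳ (gauss-zero i N i<N)) (zeroˡ _))) (+-identityʳ _)))) ⟩
    Σ (suc N) (A ∘ toℕ) + Σ (suc N) (B ∘ toℕ)
      ≈⟨ sym (Σ-+ (suc N) (A ∘ toℕ) (B ∘ toℕ)) ⟩
    Σ (suc N) (λ l → A (toℕ l) + B (toℕ l))
      ≈⟨ Σ-cong (suc N) (λ l → trans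
           (solve 4 (λ g t r u → g :* t :+ (r :* g) :* u := g :* (t :+ r :* u)) refl (gauss q i (toℕ l)) _ _ _)
           (*-congˡ (sym (diff (toℕ l) p)))) ⟩
    Σ (suc N) (λ l → gauss q i (toℕ l) * T (toℕ l) (suc p))
      -- The induction moves one unit from i to the base point, which is why p is arbitrary.
      ≈⟨ q-Newton T diff (suc N) i (suc p) (ℕ.m<n⇒m<1+n i<N) ⟩
    T 0 (i ℕ.+ suc p)
      ≈⟨ reflexive (≡.cong (T 0) (ℕ.+-suc i p)) ⟩
    T 0 (suc i ℕ.+ p) ∎
    where
    A B : ℕ → Carrier
    A l = gauss q i l * T (suc l) p
    B l = (q ^ l * gauss q i l) * T l p

-- The q-Fibonacci sequence extended to integer indices

module FibonacciDeterminant {c ℓ : Level} (R : CommutativeRing c ℓ) (x q qi : CommutativeRing.Carrier R)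
  (q-inverse : CommutativeRing._≈_ R (CommutativeRing._*_ R q qi) (CommutativeRing.1# R))
  (r d : ℕ) where
  open CommutativeRing R hiding (zero)
  open WithRing R
  open Sums R
  open Determinants R
  open QBinomials R q qi q-inverse
  open Algebra.Solver.Ring.NaturalCoefficients.Default commutativeSemiring
  open Relation.Binary.Reasoning.Setoid setoid

  -- Taking r and d as parameters encodes r < k and turns k - r - 1, k - r and k - 1 into d, d + 1
  -- and r + d.
  k : ℕ
  k = suc (r ℕ.+ d)

  K : ℤ
  K = + k

  F : ℕ → Carrier
  F = qFib k x q

  fibAux-fuel : ∀ fu fu′ N → N ℕ.< fu → N ℕ.< fu′ → fibAux k x q fu N ≈ fibAux k x q fu′ N
  fibAux-fuel (suc fu) (suc fu′) N N<fu N<fu′ with N ℕ.<? k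
  ... | yes _ = refl
  fibAux-fuel (suc fu) (suc fu′) zero    _ _ | no 0≮k = contradiction (s≤s z≤n) 0≮k
  fibAux-fuel (suc fu) (suc fu′) (suc N) (s≤s N<fu) (s≤s N<fu′) | no _ = +-cong
    (*-congˡ (fibAux-fuel fu fu′ N N<fu N<fu′))
    (*-congˡ (fibAux-fuel fu fu′ (N ℕ.∸ (r ℕ.+ d))
      (ℕ.≤-<-trans (ℕ.m∸n≤m N (r ℕ.+ d)) N<fu) (ℕ.≤-<-trans (ℕ.m∸n≤m N (r ℕ.+ d)) N<fu′)))

  F-small : ∀ N → N ℕ.< k → F N ≈ x ^ N
  F-small N N<k with N ℕ.<? k
  ... | yes _   = refl
  ... | no  N≮k = contradiction N<k N≮k

  F-large : ∀ n → x * F (n ℕ.+ (r ℕ.+ d)) + q ^ n * F n ≈ F (suc (n ℕ.+ (r ℕ.+ d)))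
  F-large n with suc (n ℕ.+ (r ℕ.+ d)) ℕ.<? k
  ... | yes n+k<k = contradiction (ℕ.≤-trans n+k<k (s≤s (ℕ.m≤n+m (r ℕ.+ d) n))) (ℕ.<-irrefl ≡.refl)
  ... | no  _ rewrite ℕ.m+n∸n≡m n (r ℕ.+ d) = +-congˡ (*-congˡ
    (fibAux-fuel (suc n) (suc (n ℕ.+ (r ℕ.+ d))) n (ℕ.n<1+n n) (s≤s (ℕ.m≤m+n n (r ℕ.+ d)))))

  -- F extended by zero to negative indices; the recurrence then holds everywhere
  -- except between the indices -1 and 0.
  Fᶻ : ℤ → Carrier
  Fᶻ (+ N)    = F N
  Fᶻ -[1+ N ] = 0#

  Fᶻ-cong : ∀ {i j} → i ≡ j → Fᶻ i ≈ Fᶻ j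
  Fᶻ-cong e = reflexive (≡.cong Fᶻ e)

  binom-cong : ∀ {a b i j} → a ≡ b → i ≡ j → binom a i ≈ binom b j
  binom-cong e f = reflexive (≡.cong₂ binom e f)

  negative : ∀ {m n} → m ℕ.< n → ∃ λ o → + m ℤ.- + n ≡ -[1+ o ]
  negative {m} m<n with ℕ.m≤n⇒∃[o]m+o≡n m<n
  ... | o , ≡.refl = o , e (+ m) (+ o)
    where
    e : ∀ m o → m ℤ.- (+ 1 ℤ.+ m ℤ.+ o) ≡ ℤ.- (+ 1 ℤ.+ o)
    e = solve-∀

  binom-negative : ∀ a {m n} → m ℕ.< n → binom a (+ m ℤ.- + n) ≈ 0#
  binom-negative a m<n with negative m<n
  ... | o , e = binom-cong ≡.refl e

  Fᶻ-negative : ∀ {i m n} → i ≡ + m ℤ.- + n → m ℕ.< n → Fᶻ i ≈ 0#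
  Fᶻ-negative e m<n with negative m<n
  ... | o , f = Fᶻ-cong (≡.trans e f)

  -- At N = -1 the left side would be 0 while F_0 = 1.
  Fᶻ-rec : ∀ N → N ≢ -[1+ 0 ] →
           x * Fᶻ N + q^ (N ℤ.+ + 1 ℤ.- K) * Fᶻ (N ℤ.+ + 1 ℤ.- K) ≈ Fᶻ (N ℤ.+ + 1)
  Fᶻ-rec -[1+ zero ]  N≢-1 = contradiction ≡.refl N≢-1
  Fᶻ-rec -[1+ suc N ] _    = trans (+-cong (zeroʳ _) (zeroʳ _)) (+-identityʳ 0#)
  Fᶻ-rec (+ n)        _    with n ℕ.<? r ℕ.+ d
  -- Here N + 1 - k is negative and both remaining values of F are plain powers of x.
  ... | yes n<k-1 = begin
    x * F n + q^ (+ n ℤ.+ + 1 ℤ.- K) * Fᶻ (+ n ℤ.+ + 1 ℤ.- K)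
      ≈⟨ +-cong (*-congˡ (F-small n (ℕ.m<n⇒m<1+n n<k-1)))
           (trans (*-congˡ (Fᶻ-negative ≡.refl n+1<k)) (zeroʳ _)) ⟩
    x * x ^ n + 0#     ≈⟨ +-identityʳ _ ⟩
    x ^ suc n          ≈⟨ sym (F-small (suc n) (s≤s n<k-1)) ⟩
    F (suc n)          ≈⟨ reflexive (≡.cong F (ℕ.+-comm 1 n)) ⟩
    F (n ℕ.+ 1)        ∎
    where
    n+1<k : n ℕ.+ 1 ℕ.< k
    n+1<k = ≡.subst (ℕ._< k) (ℕ.+-comm 1 n) (s≤s n<k-1)
  ... | no n≮k-1 with ℕ.m≤n⇒∃[o]m+o≡n (ℕ.≮⇒≥ n≮k-1)
  ... | o , ≡.refl = begin
    x * F (r ℕ.+ d ℕ.+ o) + q^ i * Fᶻ i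
      ≈⟨ +-cong (*-congˡ (reflexive (≡.cong F (ℕ.+-comm (r ℕ.+ d) o))))
           (*-cong (q^-cong (e (+ r) (+ d) (+ o))) (Fᶻ-cong (e (+ r) (+ d) (+ o)))) ⟩
    x * F (o ℕ.+ (r ℕ.+ d)) + q ^ o * F o
      ≈⟨ F-large o ⟩
    F (suc (o ℕ.+ (r ℕ.+ d)))
      ≈⟨ reflexive (≡.cong F (≡.trans (ℕ.+-comm 1 _) (≡.cong (ℕ._+ 1) (ℕ.+-comm o (r ℕ.+ d))))) ⟩
    F (r ℕ.+ d ℕ.+ o ℕ.+ 1) ∎
    where
    i : ℤ
    i = + (r ℕ.+ d ℕ.+ o) ℤ.+ + 1 ℤ.- K
    e : ∀ r d o → r ℤ.+ d ℤ.+ o ℤ.+ + 1 ℤ.- (+ 1 ℤ.+ (r ℤ.+ d)) ≡ o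
    e = solve-∀

  -- The sums P^c and the step from c to c + 1

  -- The c of P^c is parametrised as top e = e − (k − 1), so c = r + 1 − k and c = r + 1
  -- correspond to e = r and e = k + r.
  top : ℕ → ℤ
  top e = + e ℤ.- + (r ℕ.+ d)

  -- The exponent is forced: for the cancellation in `x*P` it must change by (c-j+l) - (kl+c) = -j -
  -- (k-1)l from l to l + 1. As c drops out, one weight serves every c.
  weight : ℕ → ℕ → Carrier
  weight j l = (- 1#) ^ l * q^ (ℤ.- (+ l ℤ.* + j) ℤ.- + (r ℕ.+ d) ℤ.* + tri l)

  term : ℕ → ℕ → ℕ → Carrier
  term e j l = weight j l * (binom (top e) (+ suc j ℤ.- + l) * Fᶻ (K ℤ.* + l ℤ.+ top e ℤ.- + 1))

  P : ℕ → ℕ → Carrier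
  P e j = Σ (suc (suc j)) (term e j ∘ toℕ)

  -- The q-binomial hides the exception of `Fᶻ-rec`. For l = 0 the index is c - 1, which is -1 only
  -- if c = 0, and then [0, j+1] = 0. For l ≥ 1 it is k(l-1) + e ≥ 0.
  binom*Fᶻ-rec : ∀ e j l → let N = K ℤ.* + l ℤ.+ top e ℤ.- + 1 ; M = N ℤ.+ + 1 ℤ.- K in
    binom (top e) (+ suc j ℤ.- + l) * (x * Fᶻ N + q^ M * Fᶻ M) ≈
    binom (top e) (+ suc j ℤ.- + l) * Fᶻ (N ℤ.+ + 1)
  binom*Fᶻ-rec e j zero with K ℤ.* + 0 ℤ.+ top e ℤ.- + 1 ℤ.≟ -[1+ 0 ]
  ... | no  N≢-1 = *-congˡ (Fᶻ-rec _ N≢-1)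
  ... | yes N≡-1 = trans (vanish _) (sym (vanish _))
    where
    e₁ : ∀ K t → t ≡ (K ℤ.* + 0 ℤ.+ t ℤ.- + 1) ℤ.+ + 1
    e₁ = solve-∀
    vanish : ∀ y → binom (top e) (+ suc j ℤ.- + 0) * y ≈ 0#
    vanish y = trans (*-congʳ (binom-cong
      (≡.trans (e₁ K (top e)) (≡.cong (ℤ._+ + 1) N≡-1)) (ℤ.+-identityʳ (+ suc j)))) (zeroˡ y)
  binom*Fᶻ-rec e j (suc l) = *-congˡ (Fᶻ-rec _ (λ N≡-1 → nonneg (≡.trans (≡.sym N-eq) N≡-1)))
    where
    e₁ : ∀ k₀ l e → (+ 1 ℤ.+ k₀) ℤ.* (+ 1 ℤ.+ l) ℤ.+ (e ℤ.- k₀) ℤ.- + 1 ≡ (+ 1 ℤ.+ k₀) ℤ.* l ℤ.+ e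
    e₁ = solve-∀
    N-eq : K ℤ.* + suc l ℤ.+ top e ℤ.- + 1 ≡ + (k ℕ.* l ℕ.+ e)
    N-eq = ≡.trans (e₁ (+ (r ℕ.+ d)) (+ l) (+ e)) (≡.cong (ℤ._+ + e) (≡.sym (ℤ.pos-* k l)))
    nonneg : ∀ {n} → + n ≢ -[1+ 0 ]
    nonneg ()

  -- The recurrence of F gives `x * term e j l + U l ≈ mid l`, and the q-Pascal rule gives
  -- `term (suc e) j l + U (suc l) ≈ mid l`, so `U` telescopes. Its last value contains a q-binomial
  -- with lower index -1, its first the value of F at c - k; the bound on e says exactly that c - k
  -- is negative.
  x*P : ∀ e j → e ℕ.≤ (r ℕ.+ d) ℕ.+ (r ℕ.+ d) → x * P e j ≈ P (suc e) j
  x*P e j e≤ = begin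
    x * P e j
      ≈⟨ *-Σ (suc (suc j)) x (term e j ∘ toℕ) ⟩
    Σ (suc (suc j)) (λ l → x * term e j (toℕ l))
      ≈⟨ sym (trans (+-congˡ U-first) (+-identityʳ _)) ⟩
    Σ (suc (suc j)) (λ l → x * term e j (toℕ l)) + U 0
      ≈⟨ Σ-telescope (suc (suc j)) (λ l → x * term e j l) (term (suc e) j) U
           (λ l → trans (lower l) (sym (raise l))) ⟩
    P (suc e) j + U (suc (suc j))
      ≈⟨ trans (+-congˡ U-last) (+-identityʳ _) ⟩
    P (suc e) j ∎
    where
    b : ℕ → Carrier
    b l = binom (top e) (+ suc j ℤ.- + l)
    N M : ℕ → ℤ
    N l = K ℤ.* + l ℤ.+ top e ℤ.- + 1
    M l = N l ℤ.+ + 1 ℤ.- K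
    U mid : ℕ → Carrier
    U l = weight j l * (b l * (q^ (M l) * Fᶻ (M l)))
    mid l = weight j l * (b l * Fᶻ (N l ℤ.+ + 1))

    U-first : U 0 ≈ 0#
    U-first = trans (*-congˡ (trans (*-congˡ (trans (*-congˡ
      (Fᶻ-negative (e₁ (+ (r ℕ.+ d)) (+ e)) (s≤s e≤))) (zeroʳ _))) (zeroʳ _))) (zeroʳ _)
      where
      e₁ : ∀ k₀ e → ((+ 1 ℤ.+ k₀) ℤ.* + 0 ℤ.+ (e ℤ.- k₀) ℤ.- + 1) ℤ.+ + 1 ℤ.- (+ 1 ℤ.+ k₀) ≡
                    e ℤ.- (+ 1 ℤ.+ (k₀ ℤ.+ k₀))
      e₁ = solve-∀

    U-last : U (suc (suc j)) ≈ 0#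
    U-last = trans (*-congˡ (trans (*-congʳ
      (binom-negative (top e) (ℕ.n<1+n (suc j)))) (zeroˡ _))) (zeroʳ _)

    lower : ∀ l → x * term e j l + U l ≈ mid l
    lower l = trans
      (solve 6 (λ x w b f p g → x :* (w :* (b :* f)) :+ w :* (b :* (p :* g))
        := w :* (b :* (x :* f :+ p :* g))) refl x (weight j l) (b l) (Fᶻ (N l)) _ _)
      (*-congˡ (binom*Fᶻ-rec e j l))

    raise : ∀ l → term (suc e) j l + U (suc l) ≈ mid l
    raise l = begin
      (s * q^ A) * (binom (top (suc e)) D * Fᶻ (K ℤ.* + l ℤ.+ top (suc e) ℤ.- + 1)) + U (suc l)
        ≈⟨ +-cong
             (*-congˡ (*-cong
               (trans (binom-cong {i = D} (e₁ (+ (r ℕ.+ d)) (+ e)) ≡.refl) (binom-pascal (top e) D))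
               (Fᶻ-cong (e₂ (K ℤ.* + l) (+ (r ℕ.+ d)) (+ e)))))
             (*-congˡ (*-cong (binom-cong ≡.refl (e₃ (+ j) (+ l)))
               (*-cong refl (Fᶻ-cong (e₄ (+ (r ℕ.+ d)) (+ l) (+ e)))))) ⟩
      (s * q^ A) * ((q^ G * β + b l) * f) + (((- 1#) * s) * q^ A′) * (β * (q^ (M (suc l)) * f))
        ≈⟨ solve 9 (λ m s a g β b f a′ p →
             (s :* a) :* ((g :* β :+ b) :* f) :+ ((m :* s) :* a′) :* (β :* (p :* f))
             := ((a :* g) :* (s :* (β :* f)) :+ m :* ((a′ :* p) :* (s :* (β :* f)))) :+ (s :* a) :* (b :* f))
             refl (- 1#) s (q^ A) (q^ G) β (b l) f (q^ A′) (q^ (M (suc l))) ⟩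
      ((q^ A * q^ G) * y + (- 1#) * ((q^ A′ * q^ (M (suc l))) * y)) + mid l
        -- The two terms containing [c, D-1] have the same exponent `H` and opposite signs.
        ≈⟨ +-congʳ (trans (+-cong
             (*-congʳ (q^-combine A G H ≡.refl))
             (*-congˡ (*-congʳ (q^-combine A′ (M (suc l)) H (e₅ (+ (r ℕ.+ d)) (+ e) (+ j) (+ l) (+ tri l))))))
             (trans (+-comm _ _) (-1*x+x≈0 _))) ⟩
      0# + mid l
        ≈⟨ +-identityˡ _ ⟩
      mid l ∎
      where
      D A A′ G H : ℤ
      D = + suc j ℤ.- + l
      A = ℤ.- (+ l ℤ.* + j) ℤ.- + (r ℕ.+ d) ℤ.* + tri l
      A′ = ℤ.- (+ suc l ℤ.* + j) ℤ.- + (r ℕ.+ d) ℤ.* + tri (suc l)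
      G = top e ℤ.- D ℤ.+ + 1
      H = A ℤ.+ G
      s β f y : Carrier
      s = (- 1#) ^ l
      β = binom (top e) (D ℤ.- + 1)
      f = Fᶻ (N l ℤ.+ + 1)
      y = s * (β * f)
      e₁ : ∀ k₀ e → (+ 1 ℤ.+ e) ℤ.- k₀ ≡ (e ℤ.- k₀) ℤ.+ + 1
      e₁ = solve-∀
      e₂ : ∀ a k₀ e → a ℤ.+ ((+ 1 ℤ.+ e) ℤ.- k₀) ℤ.- + 1 ≡ a ℤ.+ (e ℤ.- k₀) ℤ.- + 1 ℤ.+ + 1
      e₂ = solve-∀
      e₃ : ∀ j l → (+ 1 ℤ.+ j) ℤ.- (+ 1 ℤ.+ l) ≡ (+ 1 ℤ.+ j) ℤ.- l ℤ.- + 1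
      e₃ = solve-∀
      e₄ : ∀ k₀ l e → (+ 1 ℤ.+ k₀) ℤ.* (+ 1 ℤ.+ l) ℤ.+ (e ℤ.- k₀) ℤ.- + 1 ℤ.+ + 1 ℤ.- (+ 1 ℤ.+ k₀) ≡
                      (+ 1 ℤ.+ k₀) ℤ.* l ℤ.+ (e ℤ.- k₀) ℤ.- + 1 ℤ.+ + 1
      e₄ = solve-∀
      e₅ : ∀ k₀ e j l t →
        (ℤ.- ((+ 1 ℤ.+ l) ℤ.* j) ℤ.- k₀ ℤ.* (l ℤ.+ t)) ℤ.+
          ((+ 1 ℤ.+ k₀) ℤ.* (+ 1 ℤ.+ l) ℤ.+ (e ℤ.- k₀) ℤ.- + 1 ℤ.+ + 1 ℤ.- (+ 1 ℤ.+ k₀)) ≡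
        (ℤ.- (l ℤ.* j) ℤ.- k₀ ℤ.* t) ℤ.+ ((e ℤ.- k₀) ℤ.- ((+ 1 ℤ.+ j) ℤ.- l) ℤ.+ + 1)
      e₅ = solve-∀

  x^*P : ∀ i j → i ℕ.≤ k → x ^ i * P r j ≈ P (i ℕ.+ r) j
  x^*P zero    j _       = *-identityˡ _
  x^*P (suc i) j (s≤s i≤) = begin
    (x * x ^ i) * P r j    ≈⟨ *-assoc _ _ _ ⟩
    x * (x ^ i * P r j)    ≈⟨ *-congˡ (x^*P i j (ℕ.m≤n⇒m≤1+n i≤)) ⟩
    x * P (i ℕ.+ r) j      ≈⟨ x*P (i ℕ.+ r) j (ℕ.+-mono-≤ i≤ (ℕ.m≤m+n r d)) ⟩
    P (suc i ℕ.+ r) j      ∎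

  -- The factorisation A = L B by q-differences

  -- The l-th q-difference of a ↦ [a, n]; `τ-pascal` is the recursion that `q-Newton` asks for.
  τ : ℤ → ℤ → ℕ → Carrier
  τ a n l = q^ (+ l ℤ.* (a ℤ.- n ℤ.+ + l)) * binom a (n ℤ.- + l)

  τ-pascal : ∀ a n l → τ (+ 1 ℤ.+ a) n l ≈ τ a n (suc l) + q ^ l * τ a n l
  τ-pascal a n l = begin
    q^ E * binom (+ 1 ℤ.+ a) (n ℤ.- + l)
      ≈⟨ *-congˡ (trans (binom-cong {i = n ℤ.- + l} (ℤ.+-comm (+ 1) a) ≡.refl) (binom-pascal a (n ℤ.- + l))) ⟩
    q^ E * (q^ G * binom a (n ℤ.- + l ℤ.- + 1) + binom a (n ℤ.- + l))
      ≈⟨ trans (distribˡ _ _ _) (+-congʳ (sym (*-assoc _ _ _))) ⟩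
    (q^ E * q^ G) * binom a (n ℤ.- + l ℤ.- + 1) + q^ E * binom a (n ℤ.- + l)
      ≈⟨ +-cong
           (*-cong (q^-combine E G (+ suc l ℤ.* (a ℤ.- n ℤ.+ + suc l)) (e₁ a n (+ l)))
             (binom-cong ≡.refl (e₃ n (+ l))))
           (trans (*-congʳ (sym (q^-combine (+ l) (+ l ℤ.* (a ℤ.- n ℤ.+ + l)) E (e₂ a n (+ l)))))
             (*-assoc _ _ _)) ⟩
    τ a n (suc l) + q ^ l * τ a n l ∎
    where
    E G : ℤ
    E = + l ℤ.* (+ 1 ℤ.+ a ℤ.- n ℤ.+ + l)
    G = a ℤ.- (n ℤ.- + l) ℤ.+ + 1
    e₁ : ∀ a n l → l ℤ.* (+ 1 ℤ.+ a ℤ.- n ℤ.+ l) ℤ.+ (a ℤ.- (n ℤ.- l) ℤ.+ + 1) ≡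
                   (+ 1 ℤ.+ l) ℤ.* (a ℤ.- n ℤ.+ (+ 1 ℤ.+ l))
    e₁ = solve-∀
    e₂ : ∀ a n l → l ℤ.+ l ℤ.* (a ℤ.- n ℤ.+ l) ≡ l ℤ.* (+ 1 ℤ.+ a ℤ.- n ℤ.+ l)
    e₂ = solve-∀
    e₃ : ∀ n l → n ℤ.- l ℤ.- + 1 ≡ n ℤ.- (+ 1 ℤ.+ l)
    e₃ = solve-∀

  -- l-fold q-differences of the rows of A; the case l = 0 is A itself.
  T : ℕ → ℕ → ℕ → Carrier
  T l i j = q^ (+ d ℤ.* + j) * (τ (+ i ℤ.+ top r) (+ j) l * x ^ k)
          + q^ (+ suc d ℤ.* + j) * τ (+ i ℤ.+ + suc r) (+ suc j) l

  T-difference : ∀ j l i → T l (suc i) j ≈ T (suc l) i j + q ^ l * T l i j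
  T-difference j l i = begin
    a * (τ (+ suc i ℤ.+ top r) (+ j) l * y) + b * τ (+ suc i ℤ.+ + suc r) (+ suc j) l
      ≈⟨ +-cong (*-congˡ (*-congʳ (pascal (top r) (+ j)))) (*-congˡ (pascal (+ suc r) (+ suc j))) ⟩
    a * ((t₁ + q ^ l * t₀) * y) + b * (u₁ + q ^ l * u₀)
      ≈⟨ solve 8 (λ a b y t₁ t₀ u₁ u₀ p → a :* ((t₁ :+ p :* t₀) :* y) :+ b :* (u₁ :+ p :* u₀)
           := (a :* (t₁ :* y) :+ b :* u₁) :+ p :* (a :* (t₀ :* y) :+ b :* u₀))
           refl a b y t₁ t₀ u₁ u₀ (q ^ l) ⟩
    T (suc l) i j + q ^ l * T l i j ∎
    where
    a b y t₀ t₁ u₀ u₁ : Carrier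
    a = q^ (+ d ℤ.* + j)
    b = q^ (+ suc d ℤ.* + j)
    y = x ^ k
    t₀ = τ (+ i ℤ.+ top r) (+ j) l
    t₁ = τ (+ i ℤ.+ top r) (+ j) (suc l)
    u₀ = τ (+ i ℤ.+ + suc r) (+ suc j) l
    u₁ = τ (+ i ℤ.+ + suc r) (+ suc j) (suc l)
    pascal : ∀ c n → τ (+ suc i ℤ.+ c) n l ≈ τ (+ i ℤ.+ c) n (suc l) + q ^ l * τ (+ i ℤ.+ c) n l
    pascal c n = trans (reflexive (≡.cong (λ z → τ z n l) (ℤ.+-assoc (+ 1) (+ i) c)))
      (τ-pascal (+ i ℤ.+ c) n l)

  k∸r : ∀ r → suc (r ℕ.+ d) ℕ.∸ r ≡ suc d
  k∸r zero    = ≡.refl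
  k∸r (suc r) = k∸r r

  A≈T₀ : ∀ n i j → Amat k r x q qi n i j ≈ T 0 (toℕ i) (toℕ j)
  A≈T₀ n i j = +-cong
    (*-cong (reflexive (≡.trans (≡.cong (λ m → q ^ ((m ℕ.∸ 1) ℕ.* toℕ j)) (k∸r r)) (≡.cong q^_ (ℤ.pos-* d (toℕ j)))))
      (*-congʳ (τ₀ (e₁ (+ toℕ i) (+ r) (+ d)))))
    (*-cong (reflexive (≡.trans (≡.cong (λ m → q ^ (m ℕ.* toℕ j)) (k∸r r)) (≡.cong q^_ (ℤ.pos-* (suc d) (toℕ j)))))
      (τ₀ (e₂ (+ toℕ i) (+ r))))
    where
    e₁ : ∀ i r d → i ℤ.+ r ℤ.+ + 1 ℤ.- (+ 1 ℤ.+ (r ℤ.+ d)) ≡ i ℤ.+ (r ℤ.- (r ℤ.+ d))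
    e₁ = solve-∀
    e₂ : ∀ i r → i ℤ.+ r ℤ.+ + 1 ≡ i ℤ.+ (+ 1 ℤ.+ r)
    e₂ = solve-∀
    τ₀ : ∀ {a b m} → a ≡ b → qbinom q qi a m ≈ τ b (+ m) 0
    τ₀ {a} {b} {m} e = trans (binom-cong e (≡.sym (ℤ.+-identityʳ (+ m)))) (sym (*-identityˡ _))

  B : ℕ → ℕ → Carrier
  B l j = T l 0 j

  det-A≈det-B : ∀ n → det n (Amat k r x q qi n) ≈ det n (λ l j → B (toℕ l) (toℕ j))
  det-A≈det-B n = trans
    (det-cong n (Amat k r x q qi n)
      (λ i j → Σ n λ l → gauss q (toℕ i) (toℕ l) * B (toℕ l) (toℕ j)) λ i j → begin
        Amat k r x q qi n i j      ≈⟨ A≈T₀ n i j ⟩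
        T 0 (toℕ i) (toℕ j)        ≈⟨ reflexive (≡.cong (λ m → T 0 m (toℕ j)) (≡.sym (ℕ.+-identityʳ (toℕ i)))) ⟩
        T 0 (toℕ i ℕ.+ 0) (toℕ j)
          ≈⟨ sym (q-Newton (λ l i → T l i (toℕ j)) (T-difference (toℕ j)) n (toℕ i) 0 (Fin.toℕ<n i)) ⟩
        Σ n (λ l → gauss q (toℕ i) (toℕ l) * B (toℕ l) (toℕ j)) ∎)
    (det-unitriangular-* n (λ i l → gauss q (toℕ i) (toℕ l)) (λ l j → B (toℕ l) (toℕ j))
      (λ i → gauss-diag (toℕ i)) (λ i l → gauss-zero (toℕ i) (toℕ l)))

  -- The elimination multipliers and the column relation

  -- Read off from the pivot condition: `B (suc t) t` is q^((k+1)t + r + 1), and `κ l` is the signed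
  -- inverse of the product of the first l of these subdiagonal entries.
  κ-exponent : ℕ → ℤ
  κ-exponent l = ℤ.- ((+ 1 ℤ.+ K) ℤ.* + tri l) ℤ.- + suc r ℤ.* + l

  κ : ℕ → Carrier
  κ l = (- 1#) ^ l * q^ (κ-exponent l)

  f : ℕ → Carrier
  f l = F (k ℕ.* l ℕ.+ r)

  κ₀ : κ 0 ≈ 1#
  κ₀ = trans (*-identityˡ _) (q^-cong (e (+ 1 ℤ.+ K) (+ suc r)))
    where
    e : ∀ a b → ℤ.- (a ℤ.* + 0) ℤ.- b ℤ.* + 0 ≡ + 0
    e = solve-∀

  f₀ : f 0 ≈ x ^ r
  f₀ = trans (reflexive (≡.cong (λ m → F (m ℕ.+ r)) (ℕ.*-zeroʳ k)))
    (F-small r (s≤s (ℕ.m≤m+n r d)))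

  -- In row l the two q-binomials have lower indices t - l and t + 1 - l. Both are negative below
  -- the subdiagonal; on it only the second summand survives, with [r+1, 0] = 1.
  B-upper : ∀ a t → t ℕ.< a → B (suc a) t ≈ 0#
  B-upper a t t<a = trans
    (+-cong
      (trans (*-congˡ (trans (*-congʳ (trans (*-congˡ (binom-negative _ (ℕ.m<n⇒m<1+n t<a))) (zeroʳ _))) (zeroˡ _))) (zeroʳ _))
      (trans (*-congˡ (trans (*-congˡ (binom-negative _ (s≤s t<a))) (zeroʳ _))) (zeroʳ _)))
    (+-identityʳ 0#)

  B-subdiagonal : ∀ t → B (suc t) t ≈ q^ (+ suc d ℤ.* + t ℤ.+ + suc t ℤ.* + suc r)
  B-subdiagonal t = begin
    q^ (+ d ℤ.* + t) * (τ (+ 0 ℤ.+ top r) (+ t) (suc t) * x ^ k) + q^ (+ suc d ℤ.* + t) * τ (+ 0 ℤ.+ + suc r) (+ suc t) (suc t)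
      ≈⟨ +-cong
        (trans (*-congˡ (trans (*-congʳ (trans (*-congˡ (binom-negative _ (ℕ.n<1+n t))) (zeroʳ _))) (zeroˡ _))) (zeroʳ _))
        (*-congˡ (*-cong (q^-cong (e (+ suc r) (+ suc t)))
          (trans (binom-cong ≡.refl (ℤ.+-inverseʳ (+ suc t))) (qbinom-m-0 (+ suc r))))) ⟩
    0# + q^ (+ suc d ℤ.* + t) * (q^ (+ suc t ℤ.* + suc r) * 1#)
      ≈⟨ trans (+-identityˡ _) (*-congˡ (*-identityʳ _)) ⟩
    q^ (+ suc d ℤ.* + t) * q^ (+ suc t ℤ.* + suc r)
      ≈⟨ sym (q^-+ (+ suc d ℤ.* + t) (+ suc t ℤ.* + suc r)) ⟩
    q^ (+ suc d ℤ.* + t ℤ.+ + suc t ℤ.* + suc r) ∎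
    where
    e : ∀ r t → t ℤ.* (+ 0 ℤ.+ r ℤ.- t ℤ.+ t) ≡ t ℤ.* r
    e = solve-∀

  κ-pivot : ∀ t → κ (suc t) * ((- 1#) * B (suc t) t) ≈ κ t
  κ-pivot t = begin
    (((- 1#) * s) * q^ (κ-exponent (suc t))) * ((- 1#) * B (suc t) t)
      ≈⟨ *-congˡ (*-congˡ (B-subdiagonal t)) ⟩
    (((- 1#) * s) * q^ (κ-exponent (suc t))) * ((- 1#) * q^ E)
      ≈⟨ solve 4 (λ m s a b → ((m :* s) :* a) :* (m :* b) := (m :* m) :* (s :* (a :* b))) refl _ _ _ _ ⟩
    ((- 1#) * (- 1#)) * (s * (q^ (κ-exponent (suc t)) * q^ E))
      ≈⟨ trans (*-congʳ -1*-1≈1) (*-identityˡ _) ⟩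
    s * (q^ (κ-exponent (suc t)) * q^ E)
      ≈⟨ *-congˡ (q^-combine (κ-exponent (suc t)) E (κ-exponent t) (e (+ r) (+ d) (+ t) (+ tri t))) ⟩
    κ t ∎
    where
    s : Carrier
    s = (- 1#) ^ t
    E : ℤ
    E = + suc d ℤ.* + t ℤ.+ + suc t ℤ.* + suc r
    e : ∀ r d t u →
      (ℤ.- ((+ 1 ℤ.+ (+ 1 ℤ.+ (r ℤ.+ d))) ℤ.* (t ℤ.+ u)) ℤ.- (+ 1 ℤ.+ r) ℤ.* (+ 1 ℤ.+ t)) ℤ.+
        ((+ 1 ℤ.+ d) ℤ.* t ℤ.+ (+ 1 ℤ.+ t) ℤ.* (+ 1 ℤ.+ r)) ≡
      ℤ.- ((+ 1 ℤ.+ (+ 1 ℤ.+ (r ℤ.+ d))) ℤ.* u) ℤ.- (+ 1 ℤ.+ r) ℤ.* t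
    e = solve-∀

  square≡2tri+ : ∀ l → + l ℤ.* + l ≡ + tri l ℤ.+ + tri l ℤ.+ + l
  square≡2tri+ zero    = ≡.refl
  square≡2tri+ (suc l) = ≡.trans (e₁ (+ l))
    (≡.trans (≡.cong (λ z → z ℤ.+ + l ℤ.+ + l ℤ.+ + 1) (square≡2tri+ l)) (e₂ (+ l) (+ tri l)))
    where
    e₁ : ∀ l → (+ 1 ℤ.+ l) ℤ.* (+ 1 ℤ.+ l) ≡ l ℤ.* l ℤ.+ l ℤ.+ l ℤ.+ + 1
    e₁ = solve-∀
    e₂ : ∀ l t → t ℤ.+ t ℤ.+ l ℤ.+ l ℤ.+ l ℤ.+ + 1 ≡ l ℤ.+ t ℤ.+ (l ℤ.+ t) ℤ.+ (+ 1 ℤ.+ l)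
    e₂ = solve-∀

  -- The ring solver sees `tri l` as an indeterminate, so the exponent identities in `κfB` hold as
  -- polynomials only up to l² - (2 tri l + l), which is zero by `square≡2tri+`.
  modulo-square : ∀ l {i j} →
    i ≡ j ℤ.+ (+ l ℤ.* + l ℤ.- (+ tri l ℤ.+ + tri l ℤ.+ + l)) → i ≡ j
  modulo-square l {i} {j} e = ≡.trans e
    (≡.trans (≡.cong (λ z → j ℤ.+ z) (ℤ.i≡j⇒i-j≡0 (square≡2tri+ l))) (ℤ.+-identityʳ j))

  -- The second summand of `B l t` gives term l of P^(r+1). The first gives term l + 1 of P^(r+1-k),
  -- because t - l = (t+1) - (l+1) and kl + r = k(l+1) + (r+1-k) - 1; passing to l + 1 flips the
  -- sign of the weight, hence the minus. The common power of q is independent of l.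
  κfB : ∀ t l → (κ l * f l) * B l t ≈
        q^ (+ suc d ℤ.* + t) * (term (k ℕ.+ r) t l + (- 1#) * (x ^ k * term r t (suc l)))
  κfB t l = begin
    ((s * q^ E) * f l) * (q^ (+ d ℤ.* + t) * ((q^ X₁ * b₁) * x ^ k) + q^ G * (q^ X₂ * b₂))
      ≈⟨ solve 10 (λ s e f d x₁ b₁ y g x₂ b₂ →
           ((s :* e) :* f) :* (d :* ((x₁ :* b₁) :* y) :+ g :* (x₂ :* b₂))
           := ((e :* (g :* x₂)) :* (s :* (b₂ :* f))) :+ ((e :* (d :* x₁)) :* (s :* (y :* (b₁ :* f)))))
           refl s (q^ E) (f l) (q^ (+ d ℤ.* + t)) (q^ X₁) b₁ (x ^ k) (q^ G) (q^ X₂) b₂ ⟩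
    (q^ E * (q^ G * q^ X₂)) * (s * (b₂ * f l)) + (q^ E * (q^ (+ d ℤ.* + t) * q^ X₁)) * (s * (x ^ k * (b₁ * f l)))
      ≈⟨ +-cong
           (*-cong (combine G X₂ G Z₂ (modulo-square l (e₂ (+ r) (+ d) (+ t) (+ l) (+ tri l))))
             (*-congˡ (*-cong (binom-cong {i = + suc t ℤ.- + l} (e₃ (+ r) (+ d)) ≡.refl) (F-index (e₄ (+ r) (+ d) (+ l))))))
           (*-cong (combine (+ d ℤ.* + t) X₁ G Z₁ (modulo-square l (e₁ (+ r) (+ d) (+ t) (+ l) (+ tri l))))
             (*-congˡ (*-congˡ (*-cong (binom-cong (ℤ.+-identityˡ (top r)) (e₅ (+ t) (+ l))) (F-index (e₆ (+ r) (+ d) (+ l))))))) ⟩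
    (q^ G * q^ Z₂) * (s * h₂) + (q^ G * q^ Z₁) * (s * (x ^ k * h₁))
      ≈⟨ +-congˡ (sym (trans (*-congʳ -1*-1≈1) (*-identityˡ _))) ⟩
    (q^ G * q^ Z₂) * (s * h₂) + ((- 1#) * (- 1#)) * ((q^ G * q^ Z₁) * (s * (x ^ k * h₁)))
      ≈⟨ solve 8 (λ g z₂ s h₂ z₁ y h₁ m →
           (g :* z₂) :* (s :* h₂) :+ (m :* m) :* ((g :* z₁) :* (s :* (y :* h₁)))
           := g :* ((s :* z₂) :* h₂ :+ m :* (y :* (((m :* s) :* z₁) :* h₁))))
           refl (q^ G) (q^ Z₂) s h₂ (q^ Z₁) (x ^ k) h₁ (- 1#) ⟩
    q^ G * ((s * q^ Z₂) * h₂ + (- 1#) * (x ^ k * ((((- 1#) * s) * q^ Z₁) * h₁))) ∎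
    where
    s b₁ b₂ h₁ h₂ : Carrier
    s = (- 1#) ^ l
    b₁ = binom (+ 0 ℤ.+ top r) (+ t ℤ.- + l)
    b₂ = binom (+ 0 ℤ.+ + suc r) (+ suc t ℤ.- + l)
    h₁ = binom (top r) (+ suc t ℤ.- + suc l) * Fᶻ (K ℤ.* + suc l ℤ.+ top r ℤ.- + 1)
    h₂ = binom (top (k ℕ.+ r)) (+ suc t ℤ.- + l) * Fᶻ (K ℤ.* + l ℤ.+ top (k ℕ.+ r) ℤ.- + 1)
    E G X₁ X₂ Z₁ Z₂ : ℤ
    E = κ-exponent l
    G = + suc d ℤ.* + t
    X₁ = + l ℤ.* (+ 0 ℤ.+ top r ℤ.- + t ℤ.+ + l)
    X₂ = + l ℤ.* (+ 0 ℤ.+ + suc r ℤ.- + suc t ℤ.+ + l)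
    Z₁ = ℤ.- (+ suc l ℤ.* + t) ℤ.- + (r ℕ.+ d) ℤ.* + tri (suc l)
    Z₂ = ℤ.- (+ l ℤ.* + t) ℤ.- + (r ℕ.+ d) ℤ.* + tri l
    combine : ∀ i j g z → E ℤ.+ (i ℤ.+ j) ≡ g ℤ.+ z → q^ E * (q^ i * q^ j) ≈ q^ g * q^ z
    combine i j g z e = trans (*-congˡ (sym (q^-+ i j))) (trans (q^-combine E (i ℤ.+ j) (g ℤ.+ z) e) (q^-+ g z))
    F-index : ∀ {i} → K ℤ.* + l ℤ.+ + r ≡ i → f l ≈ Fᶻ i
    F-index e = Fᶻ-cong (≡.trans (≡.cong (ℤ._+ + r) (ℤ.pos-* k l)) e)
    e₁ : ∀ r d t l u →
      (ℤ.- ((+ 1 ℤ.+ (+ 1 ℤ.+ (r ℤ.+ d))) ℤ.* u) ℤ.- (+ 1 ℤ.+ r) ℤ.* l) ℤ.+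
        (d ℤ.* t ℤ.+ l ℤ.* (+ 0 ℤ.+ (r ℤ.- (r ℤ.+ d)) ℤ.- t ℤ.+ l)) ≡
      ((+ 1 ℤ.+ d) ℤ.* t ℤ.+ (ℤ.- ((+ 1 ℤ.+ l) ℤ.* t) ℤ.- (r ℤ.+ d) ℤ.* (l ℤ.+ u)))
        ℤ.+ (l ℤ.* l ℤ.- (u ℤ.+ u ℤ.+ l))
    e₁ = solve-∀
    e₂ : ∀ r d t l u →
      (ℤ.- ((+ 1 ℤ.+ (+ 1 ℤ.+ (r ℤ.+ d))) ℤ.* u) ℤ.- (+ 1 ℤ.+ r) ℤ.* l) ℤ.+
        ((+ 1 ℤ.+ d) ℤ.* t ℤ.+ l ℤ.* (+ 0 ℤ.+ (+ 1 ℤ.+ r) ℤ.- (+ 1 ℤ.+ t) ℤ.+ l)) ≡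
      ((+ 1 ℤ.+ d) ℤ.* t ℤ.+ (ℤ.- (l ℤ.* t) ℤ.- (r ℤ.+ d) ℤ.* u))
        ℤ.+ (l ℤ.* l ℤ.- (u ℤ.+ u ℤ.+ l))
    e₂ = solve-∀
    e₃ : ∀ r d → + 0 ℤ.+ (+ 1 ℤ.+ r) ≡ (+ 1 ℤ.+ (r ℤ.+ d) ℤ.+ r) ℤ.- (r ℤ.+ d)
    e₃ = solve-∀
    e₄ : ∀ r d l → (+ 1 ℤ.+ (r ℤ.+ d)) ℤ.* l ℤ.+ r ≡
                   (+ 1 ℤ.+ (r ℤ.+ d)) ℤ.* l ℤ.+ ((+ 1 ℤ.+ (r ℤ.+ d) ℤ.+ r) ℤ.- (r ℤ.+ d)) ℤ.- + 1
    e₄ = solve-∀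
    e₅ : ∀ t l → t ℤ.- l ≡ (+ 1 ℤ.+ t) ℤ.- (+ 1 ℤ.+ l)
    e₅ = solve-∀
    e₆ : ∀ r d l → (+ 1 ℤ.+ (r ℤ.+ d)) ℤ.* l ℤ.+ r ≡
                   (+ 1 ℤ.+ (r ℤ.+ d)) ℤ.* (+ 1 ℤ.+ l) ℤ.+ (r ℤ.- (r ℤ.+ d)) ℤ.- + 1
    e₆ = solve-∀

  -- Both boundary terms vanish: at l = 0 the index of F is r - k < 0, and at l = t + 2 the lower
  -- index of the q-binomial is -1.
  P-shift : ∀ t → Σ (suc (suc t)) (term r t ∘ suc ∘ toℕ) ≈ P r t
  P-shift t = begin
    Σ (suc (suc t)) (term r t ∘ suc ∘ toℕ)
      ≈⟨ sym (trans (+-congˡ first) (+-identityʳ _)) ⟩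
    Σ (suc (suc t)) (term r t ∘ suc ∘ toℕ) + term r t 0
      ≈⟨ Σ-telescope (suc (suc t)) (term r t ∘ suc) (term r t) (term r t) (λ l → +-comm _ _) ⟩
    P r t + term r t (suc (suc t))
      ≈⟨ trans (+-congˡ last) (+-identityʳ _) ⟩
    P r t ∎
    where
    e : ∀ r d → (+ 1 ℤ.+ (r ℤ.+ d)) ℤ.* + 0 ℤ.+ (r ℤ.- (r ℤ.+ d)) ℤ.- + 1 ≡ r ℤ.- (+ 1 ℤ.+ (r ℤ.+ d))
    e = solve-∀
    first : term r t 0 ≈ 0#
    first = trans (*-congˡ (trans (*-congˡ
      (Fᶻ-negative (e (+ r) (+ d)) (s≤s (ℕ.m≤m+n r d)))) (zeroʳ _))) (zeroʳ _)
    last : term r t (suc (suc t)) ≈ 0#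
    last = trans (*-congˡ (trans (*-congʳ
      (binom-negative (top r) (ℕ.n<1+n (suc t)))) (zeroˡ _))) (zeroʳ _)

  ΣκfB≈0 : ∀ t → Σ (suc (suc t)) (λ l → (κ (toℕ l) * f (toℕ l)) * B (toℕ l) t) ≈ 0#
  ΣκfB≈0 t = begin
    Σ m (λ l → (κ (toℕ l) * f (toℕ l)) * B (toℕ l) t)
      ≈⟨ Σ-cong m (λ l → κfB t (toℕ l)) ⟩
    Σ m (λ l → g * (u l + (- 1#) * (x ^ k * v l)))
      ≈⟨ sym (*-Σ m g (λ l → u l + (- 1#) * (x ^ k * v l))) ⟩
    g * Σ m (λ l → u l + (- 1#) * (x ^ k * v l))
      ≈⟨ *-congˡ (Σ-linear m (- 1#) u (λ l → x ^ k * v l) _ (λ l → refl)) ⟩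
    g * (P (k ℕ.+ r) t + (- 1#) * Σ m (λ l → x ^ k * v l))
      ≈⟨ *-congˡ (+-congˡ (*-congˡ (begin
           Σ m (λ l → x ^ k * v l)  ≈⟨ sym (*-Σ m (x ^ k) v) ⟩
           x ^ k * Σ m v            ≈⟨ *-congˡ (P-shift t) ⟩
           x ^ k * P r t            ≈⟨ x^*P k t ℕ.≤-refl ⟩
           P (k ℕ.+ r) t            ∎))) ⟩
    g * (P (k ℕ.+ r) t + (- 1#) * P (k ℕ.+ r) t)
      ≈⟨ *-congˡ (trans (+-comm _ _) (-1*x+x≈0 _)) ⟩
    g * 0#
      ≈⟨ zeroʳ g ⟩
    0# ∎
    where
    m : ℕ
    m = suc (suc t)
    g : Carrier
    g = q^ (+ suc d ℤ.* + t)
    u v : Fin m → Carrier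
    u l = term (k ℕ.+ r) t (toℕ l)
    v l = term r t (suc (toℕ l))

  x^r*det-B : ∀ n → x ^ r * det n (λ l j → B (toℕ l) (toℕ j)) ≈ f n
  x^r*det-B zero    = trans (*-identityʳ _) (sym f₀)
  x^r*det-B (suc n) = begin
    x ^ r * det (suc n) (λ l j → B (toℕ l) (toℕ j))
      ≈⟨ *-congˡ (det-cong (suc n) (λ l j → B (toℕ l) (toℕ j)) (B₀ ∷ B₊)
           (∷-η (λ l j → B (toℕ l) (toℕ j)))) ⟩
    x ^ r * det (suc n) (B₀ ∷ B₊)
      ≈⟨ det-scale₀ n (x ^ r) B₀ B₊ ⟩
    det (suc n) ((λ j → x ^ r * B₀ j) ∷ B₊)
      -- Since `κ 0 * f 0` is x^r, the scaled first row is the l = 0 summand of `ΣκfB≈0`. The lower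
      -- rows begin at l = 1, whence the shift in `f ∘ suc`.
      ≈⟨ det-Hessenberg n (λ j → x ^ r * B 0 j) (B ∘ suc) κ (f ∘ suc) B-upper κ-pivot
           (λ t → trans (+-congʳ (*-congʳ (sym (trans (*-congʳ κ₀) (trans (*-identityˡ _) f₀))))) (ΣκfB≈0 t)) ⟩
    κ 0 * f (suc n)
      ≈⟨ trans (*-congʳ κ₀) (*-identityˡ _) ⟩
    f (suc n) ∎
    where
    B₀ : Fin (suc n) → Carrier
    B₀ j = B 0 (toℕ j)
    B₊ : Fin n → Fin (suc n) → Carrier
    B₊ l j = B (suc (toℕ l)) (toℕ j)

theorem5 : {c ℓ : Level} (R : CommutativeRing c ℓ) →
    let open CommutativeRing R
        open WithRing R
    in (x q qi : Carrier) → q * qi ≈ 1# →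
       (k r n : ℕ) → 1 ℕ.≤ k → r ℕ.< k →
       (x ^ r) * det n (Amat k r x q qi n) ≈ qFib k x q (k ℕ.* n ℕ.+ r)
theorem5 R x q qi q-inverse k r n _ r<k with ℕ.m≤n⇒∃[o]m+o≡n r<k
... | d , ≡.refl = trans (*-congˡ (det-A≈det-B n)) (x^r*det-B n)
  where
  open CommutativeRing R
  open FibonacciDeterminant R x q qi q-inverse r d
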